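{- Let $c_0$ be a proper $4$-colouring of the plane, let $\mu$ be a left-invariant finitely additive probability measure on $S_4\times E(2)$, and let $p_d$ be the associated monochromaticity probabilities (see context). Then for real $d\ge0$: (1) if $d\le\frac{\sqrt6-\sqrt2}2$, then $p_d\ge\frac1{75}$; (2) if $\frac{\sqrt6-\sqrt2}2<d\le\sqrt{\frac{14}{15}}-\frac1{\sqrt5}$, then $p_d\ge\frac{28}{2325}$; (3) if $\sqrt{\frac{14}{15}}-\frac1{\sqrt5}<d\le\frac{\sqrt{15}}4-\frac{\sqrt3}4$, then $p_d\ge\frac1{150}$; (4) if $\frac12\sqrt{5+2\sqrt3}\le d<\sqrt{\frac{19}{15}+\frac2{\sqrt5}}$, then $p_d\ge\frac1{150}$; (5) if $\sqrt{\frac{19}{15}+\frac2{\sqrt5}}\le d<\sqrt{\frac12(2+\sqrt2)(3-\sqrt3)}$, then $p_d\ge\frac{28}{2325}$; (6) if $\sqrt{\frac12(2+\sqrt2)(3-\sqrt3)}\le d\le2$, then $p_d\ge\frac1{75}$.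
   Context: Identify the plane with $\mathbb C$. A proper $4$-colouring of the plane is a map $c_0:\mathbb C\to\{1,2,3,4\}$ such that no two points at distance $1$ have the same colour. Let $S_4$ be the group of permutations of the colours and $E(2)$ the group of Euclidean isometries of the plane. The group $S_4\times E(2)$ is amenable, so there is a finitely additive probability measure $\mu$ defined on all subsets of $S_4\times E(2)$ which is left-invariant, i.e. $\mu(gE)=\mu(E)$ for all $g\in S_4\times E(2)$ and $E\subseteq S_4\times E(2)$. For $(\sigma,T)\in S_4\times E(2)$ consider the (random) colouring $c=\sigma\circ c_0\circ T^{ -1}$. For $d\ge 0$, $p_d$ denotes the probability that two points $A,B$ at distance $d$ get the same colour: $p_d=\mu(\{(\sigma,T): c(A)=c(B)\})$; by left-invariance this does not depend on the choice of $A,B$ with $|AB|=d$. The existence of $c_0$ is a standing assumption, and $c_0,\mu$ are arbitrary but fixed. -}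

module Defs where

open import Algebra.Bundles using (CommutativeRing; Group)
open import Algebra.Structures using (IsCommutativeRing)
import Algebra.Construct.DirectProduct as DirectProduct
import Algebra.Definitions.RawMonoid as RawMonoidDefinitions
import Algebra.Properties.Group as GroupProperties
import Algebra.Solver.Ring.NaturalCoefficients.Default as SemiringSolver
open import Data.Fin.Base using (Fin)
open import Data.Fin.Permutation as Perm using (Permutation′; _⟨$⟩ʳ_; _⟨$⟩ˡ_)
open import Data.Nat.Base using (ℕ)
open import Data.Product.Base using (∃; _×_; _,_; proj₁; proj₂)
open import Data.Product.Relation.Binary.Pointwise.NonDependent using (×-setoid)
open import Data.Sum.Base using (_⊎_; [_,_]′)
import Data.Sum.Base as Sum
open import Data.Unit.Base using (⊤)
open import Function.Bundles using (Inverse)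
import Function.Construct.Composition as Composition
import Function.Construct.Identity as Identity
import Function.Construct.Symmetry as Symmetry
open import Level using (0ℓ)
open import Relation.Binary.Bundles using (Setoid; DecTotalOrder)
open import Relation.Binary.Core using (Rel)
open import Relation.Binary.Definitions using (_Respects_)
open import Relation.Binary.PropositionalEquality as ≡ using (_≡_; _≢_)
import Relation.Binary.Properties.DecTotalOrder as DecTotalOrderProperties
open import Relation.Binary.Structures using (IsDecTotalOrder)
import Relation.Binary.Reasoning.Setoid as SetoidReasoning
open import Relation.Nullary using (¬_; yes; no; contradiction)

-- The real numbers are taken axiomatically, as a Dedekind-complete ordered
-- field; such a field is unique up to isomorphism.  Equality is a setoid
-- equality, so that ℝ can be modelled without quotient types.  The order is
-- decidable and arbitrary bounded inhabited predicates have suprema: this is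
-- the classical real line.

record CompleteOrderedField : Set₁ where
  infix  9 _⁻¹
  infix  8 -_
  infixl 7 _*_
  infixl 6 _+_
  infix  4 _≈_ _≤_
  field
    Carrier           : Set
    _≈_ _≤_           : Rel Carrier 0ℓ
    _+_ _*_           : Carrier → Carrier → Carrier
    -_                : Carrier → Carrier
    -- The value of 0# ⁻¹ is left unspecified.
    _⁻¹               : Carrier → Carrier
    0# 1#             : Carrier
    isCommutativeRing : IsCommutativeRing _≈_ _+_ _*_ -_ 0# 1#
    isDecTotalOrder   : IsDecTotalOrder _≈_ _≤_
    1≉0               : ¬ (1# ≈ 0#)
    ⁻¹-cong           : ∀ {x y} → x ≈ y → x ⁻¹ ≈ y ⁻¹
    ⁻¹-inverse        : ∀ {x} → ¬ (x ≈ 0#) → x * x ⁻¹ ≈ 1#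
    +-monoˡ-≤         : ∀ {x y} z → x ≤ y → x + z ≤ y + z
    *-nonNegative     : ∀ {x y} → 0# ≤ x → 0# ≤ y → 0# ≤ x * y

  UpperBound : (Carrier → Set) → Carrier → Set
  UpperBound P b = ∀ x → P x → x ≤ b

  field
    supremum : (P : Carrier → Set) → ∃ P → ∃ (UpperBound P) →
               ∃ λ s → UpperBound P s × (∀ b → UpperBound P b → s ≤ b)

  commutativeRing : CommutativeRing 0ℓ 0ℓ
  commutativeRing = record { isCommutativeRing = isCommutativeRing }

  decTotalOrder : DecTotalOrder 0ℓ 0ℓ 0ℓ
  decTotalOrder = record { isDecTotalOrder = isDecTotalOrder }

  open CommutativeRing commutativeRing public
    hiding (Carrier; _≈_; _+_; _*_; -_; 0#; 1#; isCommutativeRing)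
  open DecTotalOrder decTotalOrder public
    using (_≟_; _≤?_; total; antisym; ≤-respˡ-≈; ≤-respʳ-≈)
    renaming (refl to ≤-refl; trans to ≤-trans; reflexive to ≤-reflexive)
  open DecTotalOrderProperties decTotalOrder public
    using (_<_; ≰⇒>; ≰⇒≥; ≤∧≉⇒<; <⇒≱)

  infixl 7 _/_
  _/_ : Carrier → Carrier → Carrier
  x / y = x * y ⁻¹

  open RawMonoidDefinitions +-rawMonoid using () renaming (_×_ to _×ᵣ_)

  fromℕ : ℕ → Carrier
  fromℕ n = n ×ᵣ 1#

module SquareRoot (ℝ : CompleteOrderedField) where
  open CompleteOrderedField ℝ
  open SemiringSolver commutativeSemiring
    using (solve; _:=_; _:+_; _:*_; con)
  open GroupProperties +-group using () renaming (∙-cancelˡ to +-cancelˡ)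

  private
    ≤⇒diff : ∀ {x y} → x ≤ y → ∃ λ d → 0# ≤ d × y ≈ x + d
    ≤⇒diff {x} {y} p =
      y - x , ≤-respˡ-≈ (-‿inverseʳ x) (+-monoˡ-≤ (- x) p) , (begin
        y               ≈⟨ +-identityʳ y ⟨
        y + 0#          ≈⟨ +-congˡ (-‿inverseˡ x) ⟨
        y + (- x + x)   ≈⟨ +-assoc y (- x) x ⟨
        (y - x) + x     ≈⟨ +-comm (y - x) x ⟩
        x + (y - x)     ∎)
      where open SetoidReasoning setoid

    diff⇒≤ : ∀ {x y d} → 0# ≤ d → y ≈ x + d → x ≤ y
    diff⇒≤ {x} {y} {d} p e = ≤-respˡ-≈ (+-identityˡ x)
      (≤-respʳ-≈ (trans (+-comm d x) (sym e)) (+-monoˡ-≤ x p))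

    0≤+ : ∀ {x y} → 0# ≤ x → 0# ≤ y → 0# ≤ x + y
    0≤+ p q = ≤-trans p (diff⇒≤ q refl)

    0≤sq : ∀ x → 0# ≤ x * x
    0≤sq x = [ (λ p → *-nonNegative p p) , negative ]′ (total 0# x)
      where
      negative : x ≤ 0# → 0# ≤ x * x
      negative p with ≤⇒diff p
      ... | d , 0≤d , 0≈x+d = ≤-respʳ-≈ (+-cancelˡ (x * d) (d * d) (x * x) (begin
          x * d + d * d   ≈⟨ distribʳ d x d ⟨
          (x + d) * d     ≈⟨ *-congʳ 0≈x+d ⟨
          0# * d          ≈⟨ zeroˡ d ⟩
          0#              ≈⟨ zeroʳ x ⟨
          x * 0#          ≈⟨ *-congˡ 0≈x+d ⟩
          x * (x + d)     ≈⟨ solve 2 (λ x d → x :* (x :+ d) := x :* d :+ x :* x) refl x d ⟩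
          x * d + x * x   ∎)) (*-nonNegative 0≤d 0≤d)
        where open SetoidReasoning setoid

    0≤1 : 0# ≤ 1#
    0≤1 = ≤-respʳ-≈ (*-identityˡ 1#) (0≤sq 1#)

    sum-zero : ∀ {x y} → 0# ≤ x → 0# ≤ y → x + y ≈ 0# → x ≈ 0#
    sum-zero p q e = antisym (diff⇒≤ q (sym e)) p

    absorb : ∀ {x d e} → 0# ≤ d → 0# ≤ e → x ≈ x + (d + e) → d ≈ 0#
    absorb {x} p q eq = sum-zero p q (+-cancelˡ x _ _ (trans (sym eq) (sym (+-identityʳ x))))

    sq-zero : ∀ {x} → x * x ≈ 0# → x ≈ 0#
    sq-zero {x} e with x ≟ 0#
    ... | yes x≈0 = x≈0
    ... | no  x≉0 = begin
      x                  ≈⟨ *-identityʳ x ⟨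
      x * 1#             ≈⟨ *-congˡ (⁻¹-inverse x≉0) ⟨
      x * (x * x ⁻¹)     ≈⟨ *-assoc x x (x ⁻¹) ⟨
      x * x * x ⁻¹       ≈⟨ *-congʳ e ⟩
      0# * x ⁻¹          ≈⟨ zeroˡ (x ⁻¹) ⟩
      0#                 ∎
      where open SetoidReasoning setoid

    0≤⁻¹ : ∀ {x} → 0# ≤ x → ¬ (x ≈ 0#) → 0# ≤ x ⁻¹
    0≤⁻¹ {x} p x≉0 = ≤-respʳ-≈
      (trans (sym (*-assoc x _ _)) (trans (*-congʳ (⁻¹-inverse x≉0)) (*-identityˡ _)))
      (*-nonNegative p (0≤sq (x ⁻¹)))

    *-cancel-⁻¹ : ∀ {x} y → ¬ (x ≈ 0#) → x * (y * x ⁻¹) ≈ y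
    *-cancel-⁻¹ {x} y x≉0 = begin
      x * (y * x ⁻¹)   ≈⟨ solve 3 (λ x y z → x :* (y :* z) := y :* (x :* z)) refl x y (x ⁻¹) ⟩
      y * (x * x ⁻¹)   ≈⟨ *-congˡ (⁻¹-inverse x≉0) ⟩
      y * 1#           ≈⟨ *-identityʳ y ⟩
      y                ∎
      where open SetoidReasoning setoid

    sq-cancel-≤ : ∀ {u v} → 0# ≤ v → u * u ≤ v * v → u ≤ v
    sq-cancel-≤ {u} {v} 0≤v uu≤vv with u ≤? v
    ... | yes u≤v = u≤v
    ... | no  u≰v with ≤⇒diff (≰⇒≥ u≰v) | ≤⇒diff uu≤vv
    ... | w , 0≤w , u≈v+w | d , 0≤d , vv≈uu+d =
      ≤-reflexive (trans u≈v+w (trans (+-congˡ w≈0) (+-identityʳ v)))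
      where
      open SetoidReasoning setoid
      0≤vw : 0# ≤ v * w
      0≤vw = *-nonNegative 0≤v 0≤w
      w≈0 : w ≈ 0#
      w≈0 = sq-zero (absorb (0≤sq w) (0≤+ (0≤+ 0≤vw 0≤vw) 0≤d) (begin
        v * v                                       ≈⟨ vv≈uu+d ⟩
        u * u + d                                   ≈⟨ +-congʳ (*-cong u≈v+w u≈v+w) ⟩
        (v + w) * (v + w) + d
          ≈⟨ solve 3 (λ v w d → (v :+ w) :* (v :+ w) :+ d
               := v :* v :+ (w :* w :+ (v :* w :+ v :* w :+ d))) refl v w d ⟩
        v * v + (w * w + (v * w + v * w + d))       ∎))

    -- If a ≤ s², then u = (s² + a) / 2s satisfies u ≤ s and a ≤ u².
    square≤ : ∀ {a s} → 0# ≤ a → 0# ≤ s →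
              (∀ u → 0# ≤ u → a ≤ u * u → s ≤ u) → s * s ≤ a
    square≤ {a} {s} 0≤a 0≤s least with s * s ≤? a
    ... | yes p = p
    ... | no ss≰a with ≤⇒diff (≰⇒≥ ss≰a)
    ... | δ , 0≤δ , ss≈a+δ = ≤-reflexive (begin
        s * s               ≈⟨ ss≈a+δ ⟩
        a + δ               ≈⟨ +-congˡ 2se≈δ ⟨
        a + (s + s) * e     ≈⟨ +-congˡ (trans (*-congˡ e≈0) (zeroʳ _)) ⟩
        a + 0#              ≈⟨ +-identityʳ a ⟩
        a                   ∎)
      where
      open SetoidReasoning setoid
      2s≉0 : ¬ (s + s ≈ 0#)
      2s≉0 2s≈0 = ss≰a (≤-trans (≤-reflexive
        (trans (*-congʳ (sum-zero 0≤s 0≤s 2s≈0)) (zeroˡ s))) 0≤a)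
      k = (s + s) ⁻¹
      0≤k : 0# ≤ k
      0≤k = 0≤⁻¹ (0≤+ 0≤s 0≤s) 2s≉0
      e = δ * k
      0≤e : 0# ≤ e
      0≤e = *-nonNegative 0≤δ 0≤k
      2se≈δ : (s + s) * e ≈ δ
      2se≈δ = *-cancel-⁻¹ δ 2s≉0
      u = (s * s + a) * k
      0≤u : 0# ≤ u
      0≤u = *-nonNegative (0≤+ (0≤sq s) 0≤a) 0≤k
      s≈u+e : s ≈ u + e
      s≈u+e = begin
        s                            ≈⟨ *-cancel-⁻¹ s 2s≉0 ⟨
        (s + s) * (s * k)
          ≈⟨ solve 2 (λ s k → (s :+ s) :* (s :* k) := (s :* s :+ s :* s) :* k) refl s k ⟩
        (s * s + s * s) * k          ≈⟨ *-congʳ (+-congˡ ss≈a+δ) ⟩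
        (s * s + (a + δ)) * k
          ≈⟨ solve 4 (λ x a d k → (x :+ (a :+ d)) :* k := (x :+ a) :* k :+ d :* k)
               refl (s * s) a δ k ⟩
        u + e                        ∎
      uu≈a+ee : u * u ≈ a + e * e
      uu≈a+ee = +-cancelˡ ((u + u) * e + e * e) _ _ (begin
        (u + u) * e + e * e + u * u
          ≈⟨ solve 2 (λ u e → (u :+ u) :* e :+ e :* e :+ u :* u := (u :+ e) :* (u :+ e)) refl u e ⟩
        (u + e) * (u + e)                       ≈⟨ *-cong s≈u+e s≈u+e ⟨
        s * s                                   ≈⟨ ss≈a+δ ⟩
        a + δ                                   ≈⟨ +-congˡ 2se≈δ ⟨
        a + (s + s) * e                         ≈⟨ +-congˡ (*-congʳ (+-cong s≈u+e s≈u+e)) ⟩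
        a + (u + e + (u + e)) * e
          ≈⟨ solve 3 (λ a u e → a :+ (u :+ e :+ (u :+ e)) :* e
               := (u :+ u) :* e :+ e :* e :+ (a :+ e :* e)) refl a u e ⟩
        (u + u) * e + e * e + (a + e * e)       ∎)
      s≤u : s ≤ u
      s≤u = least u 0≤u (diff⇒≤ (0≤sq e) uu≈a+ee)
      e≈0 : e ≈ 0#
      e≈0 = let (d , 0≤d , u≈s+d) = ≤⇒diff s≤u in absorb 0≤e 0≤d
        (trans u≈s+d (trans (+-congʳ s≈u+e) (+-assoc u e d)))

    -- If s² ≤ a, put δ = a - s² and e = δ / (1 + 2s + δ); then (s + e)² ≤ a.
    ≤square : ∀ {a s} → 0# ≤ s → (∀ u → u * u ≤ a → u ≤ s) → a ≤ s * s
    ≤square {a} {s} 0≤s upper with a ≤? s * s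
    ... | yes p = p
    ... | no a≰ss with ≤⇒diff (≰⇒≥ a≰ss)
    ... | δ , 0≤δ , a≈ss+δ = ≤-reflexive (begin
        a                   ≈⟨ a≈ss+δ ⟩
        s * s + δ           ≈⟨ +-congˡ De≈δ ⟨
        s * s + D * e       ≈⟨ +-congˡ (trans (*-congˡ e≈0) (zeroʳ _)) ⟩
        s * s + 0#          ≈⟨ +-identityʳ _ ⟩
        s * s               ∎)
      where
      open SetoidReasoning setoid
      t = s + s
      0≤t : 0# ≤ t
      0≤t = 0≤+ 0≤s 0≤s
      D = 1# + (t + δ)
      D≉0 : ¬ (D ≈ 0#)
      D≉0 D≈0 = 1≉0 (sum-zero 0≤1 (0≤+ 0≤t 0≤δ) D≈0)
      k = D ⁻¹
      0≤k : 0# ≤ k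
      0≤k = 0≤⁻¹ (0≤+ 0≤1 (0≤+ 0≤t 0≤δ)) D≉0
      e = δ * k
      0≤e : 0# ≤ e
      0≤e = *-nonNegative 0≤δ 0≤k
      De≈δ : D * e ≈ δ
      De≈δ = *-cancel-⁻¹ δ D≉0
      r = e * (k * (1# + t))
      e≈ee+r : e ≈ e * e + r
      e≈ee+r = begin
        e                  ≈⟨ *-identityʳ e ⟨
        e * 1#             ≈⟨ *-congˡ (⁻¹-inverse D≉0) ⟨
        e * (D * k)
          ≈⟨ solve 4 (λ e t d k → e :* ((con 1 :+ (t :+ d)) :* k)
               := e :* (d :* k) :+ e :* (k :* (con 1 :+ t))) refl e t δ k ⟩
        e * e + r          ∎
      a≈sq+rest : a ≈ (s + e) * (s + e) + (r + δ * e)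
      a≈sq+rest = begin
        a                                       ≈⟨ a≈ss+δ ⟩
        s * s + δ                               ≈⟨ +-congˡ De≈δ ⟨
        s * s + D * e
          ≈⟨ solve 3 (λ s e d → s :* s :+ (con 1 :+ ((s :+ s) :+ d)) :* e
               := s :* s :+ (e :+ ((s :+ s) :* e :+ d :* e))) refl s e δ ⟩
        s * s + (e + (t * e + δ * e))           ≈⟨ +-congˡ (+-congʳ e≈ee+r) ⟩
        s * s + (e * e + r + (t * e + δ * e))
          ≈⟨ solve 4 (λ s e r x → s :* s :+ (e :* e :+ r :+ ((s :+ s) :* e :+ x))
               := (s :+ e) :* (s :+ e) :+ (r :+ x)) refl s e r (δ * e) ⟩
        (s + e) * (s + e) + (r + δ * e)         ∎
      bound : (s + e) * (s + e) ≤ a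
      bound = diff⇒≤ (0≤+ (*-nonNegative 0≤e (*-nonNegative 0≤k (0≤+ 0≤1 0≤t)))
                          (*-nonNegative 0≤δ 0≤e)) a≈sq+rest
      e≈0 : e ≈ 0#
      e≈0 = let (d , 0≤d , s≈s+e+d) = ≤⇒diff (upper (s + e) bound) in
        absorb 0≤e 0≤d (trans s≈s+e+d (+-assoc s e d))

  sqrt-exists : ∀ {a} → 0# ≤ a → ∃ λ s → 0# ≤ s × s * s ≈ a
  sqrt-exists {a} 0≤a = s , 0≤s , antisym
    (square≤ 0≤a 0≤s λ u 0≤u a≤uu → s-least u λ y yy≤a →
      sq-cancel-≤ 0≤u (≤-trans yy≤a a≤uu))
    (≤square 0≤s s-upper)
    where
    P : Carrier → Set
    P y = y * y ≤ a

    P-zero : P 0#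
    P-zero = ≤-respˡ-≈ (sym (zeroˡ 0#)) 0≤a

    P-bounded : UpperBound P (1# + a)
    P-bounded y yy≤a = sq-cancel-≤ (0≤+ 0≤1 0≤a) (≤-trans yy≤a
      (diff⇒≤ (0≤+ (0≤+ 0≤1 0≤a) (0≤sq a))
        (solve 1 (λ a → (con 1 :+ a) :* (con 1 :+ a)
                     := a :+ (con 1 :+ a :+ a :* a)) refl a)))

    P-sup = supremum P (0# , P-zero) (1# + a , P-bounded)
    s = proj₁ P-sup
    s-upper = proj₁ (proj₂ P-sup)
    s-least = proj₂ (proj₂ P-sup)

    0≤s : 0# ≤ s
    0≤s = s-upper 0# P-zero

  -- The nonnegative square root, with the convention √ x = 0 for x < 0.
  infix 9 √_
  √_ : Carrier → Carrier
  √ x with 0# ≤? x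
  ... | yes 0≤x = proj₁ (sqrt-exists 0≤x)
  ... | no  _   = 0#

  √-nonNegative : ∀ x → 0# ≤ √ x
  √-nonNegative x with 0# ≤? x
  ... | yes 0≤x = proj₁ (proj₂ (sqrt-exists 0≤x))
  ... | no  _   = ≤-refl

  √-square : ∀ {x} → 0# ≤ x → √ x * √ x ≈ x
  √-square {x} 0≤x with 0# ≤? x
  ... | yes p  = proj₂ (proj₂ (sqrt-exists p))
  ... | no 0≰x = contradiction 0≤x 0≰x

  √-negative : ∀ {x} → ¬ (0# ≤ x) → √ x ≈ 0#
  √-negative {x} 0≰x with 0# ≤? x
  ... | yes p = contradiction p 0≰x
  ... | no  _ = refl

  √-cong : ∀ {x y} → x ≈ y → √ x ≈ √ y
  √-cong {x} {y} x≈y with 0# ≤? x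
  ... | no 0≰x = sym (√-negative λ 0≤y → 0≰x (≤-respʳ-≈ (sym x≈y) 0≤y))
  ... | yes p  = antisym (sq-cancel-≤ (√-nonNegative y) (≤-reflexive e))
                         (sq-cancel-≤ (proj₁ (proj₂ (sqrt-exists p))) (≤-reflexive (sym e)))
    where
    e = trans (proj₂ (proj₂ (sqrt-exists p)))
              (trans x≈y (sym (√-square (≤-respʳ-≈ x≈y p))))

-- Subsets of a setoid-based group are the predicates respecting its equality.

module Subsets (G : Group 0ℓ 0ℓ) where
  open Group G

  record Subset : Set₁ where
    field
      mem      : Carrier → Set
      mem-resp : mem Respects _≈_

  open Subset public

  infix  4 _≐_
  infixl 6 _∪_

  _≐_ : Subset → Subset → Set
  E ≐ F = ∀ g → (mem E g → mem F g) × (mem F g → mem E g)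

  Disjoint : Subset → Subset → Set
  Disjoint E F = ∀ g → ¬ (mem E g × mem F g)

  _∪_ : Subset → Subset → Subset
  E ∪ F = record
    { mem      = λ g → mem E g ⊎ mem F g
    ; mem-resp = λ g≈h → Sum.map (mem-resp E g≈h) (mem-resp F g≈h)
    }

  whole : Subset
  whole = record { mem = λ _ → ⊤ ; mem-resp = λ _ t → t }

  translate : Carrier → Subset → Subset
  translate g E = record
    { mem      = λ h → ∃ λ x → mem E x × h ≈ g ∙ x
    ; mem-resp = λ { h≈h′ (x , x∈E , h≈gx) → x , x∈E , trans (sym h≈h′) h≈gx }
    }

module _ (ℝ : CompleteOrderedField) (G : Group 0ℓ 0ℓ) where
  open CompleteOrderedField ℝ
  open Subsets G

  record InvariantProbability : Set₁ where
    field
      μ             : Subset → Carrier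
      μ-cong        : ∀ {E F} → E ≐ F → μ E ≈ μ F
      nonNegative   : ∀ E → 0# ≤ μ E
      additive      : ∀ E F → Disjoint E F → μ (E ∪ F) ≈ μ E + μ F
      normalised    : μ whole ≈ 1#
      leftInvariant : ∀ g E → μ (translate g E) ≈ μ E

-- Products are composition of maps: (σ ∙ τ) i = σ (τ i), whereas σ ∘ₚ τ
-- applies σ first.
symmetricGroup : ℕ → Group 0ℓ 0ℓ
symmetricGroup n = record
  { Carrier = Permutation′ n
  ; _≈_     = Perm._≈_
  ; _∙_     = λ σ τ → τ Perm.∘ₚ σ
  ; ε       = Perm.id
  ; _⁻¹     = Perm.flip
  ; isGroup = record
    { isMonoid = record
      { isSemigroup = record
        { isMagma = record
          { isEquivalence = record
            { refl  = λ _ → ≡.refl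
            ; sym   = λ p i → ≡.sym (p i)
            ; trans = λ p q i → ≡.trans (p i) (q i)
            }
          ; ∙-cong = λ {σ} {σ′} {τ} {τ′} p q i →
              ≡.trans (≡.cong (σ ⟨$⟩ʳ_) (q i)) (p (τ′ ⟨$⟩ʳ i))
          }
        ; assoc = λ _ _ _ _ → ≡.refl
        }
      ; identity = (λ _ _ → ≡.refl) , (λ _ _ → ≡.refl)
      }
    ; inverse = (λ σ _ → Perm.inverseˡ σ) , (λ σ _ → Perm.inverseʳ σ)
    ; ⁻¹-cong = λ {σ} {τ} p i → ≡.trans
        (≡.cong (σ ⟨$⟩ˡ_) (≡.trans (≡.sym (Perm.inverseʳ τ)) (≡.sym (p (τ ⟨$⟩ˡ i)))))
        (Perm.inverseˡ σ)
    }
  }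

module Plane (ℝ : CompleteOrderedField) where
  open CompleteOrderedField ℝ
  open SquareRoot ℝ using (√_; √-cong)

  plane : Setoid 0ℓ 0ℓ
  plane = ×-setoid setoid setoid

  module ℂ = Setoid plane

  Point : Set
  Point = ℂ.Carrier

  dist : Point → Point → Carrier
  dist (a , b) (c , d) = √ ((a - c) * (a - c) + (b - d) * (b - d))

  dist-cong : ∀ {A A′ B B′} → A ℂ.≈ A′ → B ℂ.≈ B′ → dist A B ≈ dist A′ B′
  dist-cong (a , b) (c , d) = √-cong (+-cong (*-cong p p) (*-cong q q))
    where
    p = +-cong a (-‿cong c)
    q = +-cong b (-‿cong d)

  record Isometry : Set where
    field
      bijection : Inverse plane plane
    open Inverse bijection public
      using (to; from; to-cong; from-cong; strictlyInverseˡ; strictlyInverseʳ)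
    field
      isometric : ∀ A B → dist (to A) (to B) ≈ dist A B

  open Isometry

  euclideanGroup : Group 0ℓ 0ℓ
  euclideanGroup = record
    { Carrier = Isometry
    ; _≈_     = λ S T → ∀ A → to S A ℂ.≈ to T A
    ; _∙_     = λ S T → record
        { bijection = Composition.inverse (bijection T) (bijection S)
        ; isometric = λ A B → trans (isometric S (to T A) (to T B)) (isometric T A B)
        }
    ; ε       = record
        { bijection = Identity.inverse plane
        ; isometric = λ _ _ → refl
        }
    ; _⁻¹     = λ T → record
        { bijection = Symmetry.inverse (bijection T)
        ; isometric = λ A B → trans (sym (isometric T (from T A) (from T B)))
            (dist-cong (strictlyInverseˡ T A) (strictlyInverseˡ T B))
        }
    ; isGroup = record
      { isMonoid = record
        { isSemigroup = record
          { isMagma = record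
            { isEquivalence = record
              { refl  = λ _ → ℂ.refl
              ; sym   = λ p A → ℂ.sym (p A)
              ; trans = λ p q A → ℂ.trans (p A) (q A)
              }
            ; ∙-cong = λ {S} {S′} {T} {T′} p q A →
                ℂ.trans (to-cong S (q A)) (p (to T′ A))
            }
          ; assoc = λ _ _ _ _ → ℂ.refl
          }
        ; identity = (λ _ _ → ℂ.refl) , (λ _ _ → ℂ.refl)
        }
      ; inverse = (λ T → strictlyInverseʳ T) , (λ T → strictlyInverseˡ T)
      ; ⁻¹-cong = λ {S} {T} → from-pointwise S T
      }
    }
    where
    from-pointwise : ∀ S T → (∀ A → to S A ℂ.≈ to T A) → ∀ A → from S A ℂ.≈ from T A
    from-pointwise S T p A = ℂ.trans
      (from-cong S (ℂ.trans (ℂ.sym (strictlyInverseˡ T A)) (ℂ.sym (p (from T A)))))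
      (strictlyInverseʳ S (from T A))

  Colour : Set
  Colour = Fin 4

  record ProperColouring : Set where
    field
      colour      : Point → Colour
      colour-cong : ∀ {A B} → A ℂ.≈ B → colour A ≡ colour B
      proper      : ∀ A B → dist A B ≈ 1# → colour A ≢ colour B

  S₄×E₂ : Group 0ℓ 0ℓ
  S₄×E₂ = DirectProduct.group (symmetricGroup 4) euclideanGroup

  module _ (c₀ : ProperColouring) where
    open ProperColouring c₀
    open Group S₄×E₂ using () renaming (Carrier to G)
    open Subsets S₄×E₂

    randomColouring : G → Point → Colour
    randomColouring (σ , T) A = σ ⟨$⟩ʳ colour (from T A)

    randomColouring-cong : ∀ {g h} → Group._≈_ S₄×E₂ g h →
                           ∀ A → randomColouring g A ≡ randomColouring h A
    randomColouring-cong {σ , S} {τ , T} (σ≈τ , S≈T) A = ≡.trans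
      (≡.cong (σ ⟨$⟩ʳ_) (colour-cong (Group.⁻¹-cong euclideanGroup {S} {T} S≈T A)))
      (σ≈τ (colour (from T A)))

    monochromatic : Point → Point → Subset
    monochromatic A B = record
      { mem      = λ g → randomColouring g A ≡ randomColouring g B
      ; mem-resp = λ {g} {h} g≈h e → ≡.trans (≡.sym (randomColouring-cong {g} {h} g≈h A))
          (≡.trans e (randomColouring-cong {g} {h} g≈h B))
      }

    -- p_d is monochromaticity μ A B for any A and B at distance d.
    monochromaticity : InvariantProbability ℝ S₄×E₂ → Point → Point → Carrier
    monochromaticity P A B = InvariantProbability.μ P (monochromatic A B)

{-# OPTIONS --safe #-}
module Submission where

-- The probability p(A,B) of a common colour depends only on |AB|, and an
-- inequality between weighted numbers of monochromatic pairs that holds for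
-- every 4-colouring of a finite configuration passes to the probabilities.
--
-- If |AB| = x ≥ 1/2, the apex of an isosceles triangle with legs x and base 1
-- shows p ≤ 1/2.  This improves to p ≤ 35/72: let the base 1 of the triangle
-- be B₀C₀, its apex A, and rotate B₀ and C₀ about A by multiples of 60° to
-- hexagons B and C.  Up to rotation the pairs BᵢCᵢ₊₁ and Bᵢ₊₁Cᵢ are congruent
-- to the segments from A to the two points D forming a unit triangle with B₀
-- and C₀, so their probability is at most 1 - 2p.  If p were close
-- to 1/2, then A would agree with all vertices of one hexagon and with none of
-- the other, which would carry three colours only; this gives too many
-- monochromatic pairs, as the diagonals of a hexagon are longer than x and
-- have probability at most 1/2.
--
-- For 0 ≤ d ≤ 2 take two unit chords of a unit circle that differ by a
-- rotation moving points by d.  Their four endpoints use three colours, so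
-- 1 ≤ 2 p_d + p_a + p_b, where a and b are the two remaining distances.  When
-- both are at least 1/2, that is, when 16d⁴ - 36d² + 9 ≥ 0, this gives
-- p_d ≥ 1/72, which is stronger than all six bounds; the inequality on d holds
-- in all six ranges.

import Algebra.Properties.Ring as RingProperties
import Algebra.Properties.Semiring.Mult as SemiringMult
import Algebra.Solver.Ring as RingSolver
open import Algebra.Bundles using (Group)
open import Algebra.Solver.Ring.AlmostCommutativeRing
  using (fromCommutativeRing; _-Raw-AlmostCommutative⟶_)
open import Data.Bool.Base using (if_then_else_)
open import Data.Fin.Base using (Fin)
open import Data.Fin.Patterns
open import Data.Fin.Permutation as Perm using (_⟨$⟩ʳ_; _⟨$⟩ˡ_)
import Data.Fin.Properties as Fin
import Data.Integer.Properties as ℤ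
open import Data.List.Base using (List; []; _∷_; _++_; map; allFin)
open import Data.List.Relation.Unary.All as All using (All; []; _∷_)
open import Data.Maybe.Base using (Maybe; just; nothing)
open import Data.Nat.Base as ℕ using (ℕ; zero; suc)
import Data.Nat.Properties as ℕ
open import Data.Product.Base using (∃; _×_; _,_; proj₁; proj₂)
import Data.Sign.Base as Sign
open import Data.Sum.Base using (_⊎_; inj₁; inj₂; [_,_]′)
open import Data.Unit.Base using (tt)
open import Data.Vec.Base using (Vec; lookup; []; _∷_)
open import Defs
open import Function.Base using (_∘_; id)
open import Relation.Binary.PropositionalEquality as ≡ using (_≡_; _≢_)
import Relation.Binary.Reasoning.Setoid as SetoidReasoning
open import Relation.Nullary using (¬_; Dec; yes; no; contradiction; does)
open import Relation.Nullary.Decidable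
  using (True; toWitness; map′; _×-dec_; ¬?; _→-dec_)

-- Counting monochromatic pairs in colourings of finite configurations.

module Tally where
  open import Data.Nat.Base using (_+_; _*_; _≤_; z≤n; s≤s)
  open import Relation.Binary.PropositionalEquality using (refl)

  same : ∀ {n} → Fin n → Fin n → ℕ
  same x y = if does (x Fin.≟ y) then 1 else 0

  same-≡ : ∀ {n} {x y : Fin n} → x ≡ y → same x y ≡ 1
  same-≡ {x = x} {y} x≡y with x Fin.≟ y
  ... | yes _  = refl
  ... | no x≢y = contradiction x≡y x≢y

  same-≢ : ∀ {n} {x y : Fin n} → x ≢ y → same x y ≡ 0
  same-≢ {x = x} {y} x≢y with x Fin.≟ y
  ... | yes x≡y = contradiction x≡y x≢y
  ... | no  _   = refl

  WeightedPairs : Set → Set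
  WeightedPairs V = List (ℕ × V × V)

  module _ {V : Set} where

    tally : ∀ {n} → WeightedPairs V → (V → Fin n) → ℕ
    tally []                κ = 0
    tally ((w , u , v) ∷ L) κ = w * same (κ u) (κ v) + tally L κ

    tally-++ : ∀ {n} L R (κ : V → Fin n) → tally (L ++ R) κ ≡ tally L κ + tally R κ
    tally-++ []                R κ = refl
    tally-++ ((w , u , v) ∷ L) R κ =
      ≡.trans (≡.cong (w * same (κ u) (κ v) +_) (tally-++ L R κ)) (≡.sym (ℕ.+-assoc (w * same (κ u) (κ v)) _ _))

    -- Only pairs whose common colour is `a` count. This lower bound for `tally` sees a vertex only
    -- through whether it has the colour `a`, which keeps the case check in `spokes-≤` small.
    coincidences : ∀ {n} → Fin n → WeightedPairs V → (V → Fin n) → ℕ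
    coincidences a []                κ = 0
    coincidences a ((w , u , v) ∷ L) κ = w * (same a (κ u) * same a (κ v)) + coincidences a L κ

    coincidences-≤ : ∀ {n} (a : Fin n) L κ → coincidences a L κ ≤ tally L κ
    coincidences-≤ a []                κ = z≤n
    coincidences-≤ a ((w , u , v) ∷ L) κ =
      ℕ.+-mono-≤ (ℕ.*-monoʳ-≤ w (both (κ u) (κ v))) (coincidences-≤ a L κ)
      where
      both : ∀ x y → same a x * same a y ≤ same x y
      both x y with a Fin.≟ x
      ... | no  _    = z≤n
      ... | yes refl = ℕ.≤-reflexive (ℕ.+-identityʳ (same a y))

  pairs : ∀ {V W : Set} → ℕ → (V → W) → (V → W) → List (V × V) → WeightedPairs W
  pairs w f g = map λ (i , j) → w , f i , g j

  module _ {V W : Set} (f : V → W) where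

    relabel : WeightedPairs V → WeightedPairs W
    relabel = map λ (w , u , v) → w , f u , f v

    tally-relabel : ∀ {n} L (κ : W → Fin n) → tally (relabel L) κ ≡ tally L (κ ∘ f)
    tally-relabel []                κ = refl
    tally-relabel ((w , u , v) ∷ L) κ = ≡.cong (w * same (κ (f u)) (κ (f v)) +_) (tally-relabel L κ)

  -- `diagonals` lists the six short diagonals and then the three long ones. In `adjacent` both
  -- orders occur because the first index belongs to one hexagon and the second to the other.
  sides diagonals adjacent : List (Fin 6 × Fin 6)
  sides      = (0F , 1F) ∷ (1F , 2F) ∷ (2F , 3F) ∷ (3F , 4F) ∷ (4F , 5F) ∷ (5F , 0F) ∷ []
  diagonals  = (0F , 2F) ∷ (1F , 3F) ∷ (2F , 4F) ∷ (3F , 5F) ∷ (4F , 0F) ∷ (5F , 1F)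
             ∷ (0F , 3F) ∷ (1F , 4F) ∷ (2F , 5F) ∷ []
  adjacent   = (0F , 1F) ∷ (1F , 2F) ∷ (2F , 3F) ∷ (3F , 4F) ∷ (4F , 5F) ∷ (5F , 0F)
             ∷ (1F , 0F) ∷ (2F , 1F) ∷ (3F , 2F) ∷ (4F , 3F) ∷ (5F , 4F) ∷ (0F , 5F) ∷ []


  -- The least number of monochromatic pairs among six points in four colours,
  -- m of which have a given colour.
  leastPairs : ℕ → ℕ
  leastPairs 0 = 3
  leastPairs 1 = 2
  leastPairs 2 = 2
  leastPairs 3 = 3
  leastPairs 4 = 6
  leastPairs 5 = 10
  leastPairs _ = 15

  occurrences : ∀ {m n} → Fin n → (Fin m → Fin n) → ℕ
  occurrences {zero}  a κ = 0
  occurrences {suc m} a κ = same a (κ 0F) + occurrences a (κ ∘ Fin.suc)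

  allPairs : List (Fin 6 × Fin 6)
  allPairs = sides ++ diagonals

  -- Both sides depend on `κ` only through its six values. Replacing `κ` by the vector of these
  -- values turns the claim into one about seven colours, which is decided by evaluating all cases.
  leastPairs-≤ : ∀ a (κ : Fin 6 → Fin 4) →
                 leastPairs (occurrences a κ) ≤ tally (pairs 1 id id allPairs) κ
  leastPairs-≤ a κ = check a (κ 0F) (κ 1F) (κ 2F) (κ 3F) (κ 4F) (κ 5F)
    where
    check : ∀ a b₀ b₁ b₂ b₃ b₄ b₅ → let κ = lookup (b₀ ∷ b₁ ∷ b₂ ∷ b₃ ∷ b₄ ∷ b₅ ∷ []) in
            leastPairs (occurrences a κ) ≤ tally (pairs 1 id id allPairs) κ
    check = toWitness {a? = Fin.all? λ a → Fin.all? λ b₀ → Fin.all? λ b₁ → Fin.all? λ b₂ →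
      Fin.all? λ b₃ → Fin.all? λ b₄ → Fin.all? λ b₅ → _ ℕ.≤? _} _

  -- The configuration of a centre A and two hexagons B and C. The rungs joining `inner i` to
  -- `outer i` have unit length and appear as the hypothesis `proper` of `spokes-≤`.
  data Vertex : Set where
    centre      : Vertex
    inner outer : Fin 6 → Vertex

  spokes hexagons neighbours : WeightedPairs Vertex
  spokes     = map (λ i → 7 , centre , inner i) (allFin 6) ++ map (λ i → 7 , centre , outer i) (allFin 6)
  hexagons   = pairs 1 inner inner allPairs ++ pairs 1 outer outer allPairs
  neighbours = pairs 6 inner outer adjacent

  -- The possible states of a rung relative to the colour of the centre. Its ends differ, so at most
  -- one of them has that colour, and six rungs leave only 3⁶ cases.
  data DisjointIndicators : ℕ → ℕ → Set where
    neither : DisjointIndicators 0 0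
    first   : DisjointIndicators 1 0
    second  : DisjointIndicators 0 1

  same-disjoint : ∀ {n} (a : Fin n) {x y} → x ≢ y → DisjointIndicators (same a x) (same a y)
  same-disjoint a {x} {y} x≢y with a Fin.≟ x | a Fin.≟ y
  ... | yes refl | yes refl = contradiction refl x≢y
  ... | yes _    | no  _    = first
  ... | no  _    | yes _    = second
  ... | no  _    | no  _    = neither

  disjoint? : ∀ {P : ℕ → ℕ → Set} → (∀ f g → Dec (P f g)) → Dec (∀ {f g} → DisjointIndicators f g → P f g)
  disjoint? {P} P? = map′ to from (P? 0 0 ×-dec P? 1 0 ×-dec P? 0 1)
    where
    to : P 0 0 × P 1 0 × P 0 1 → ∀ {f g} → DisjointIndicators f g → P f g
    to (x , y , z) neither = x
    to (x , y , z) first   = y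
    to (x , y , z) second  = z
    from : (∀ {f g} → DisjointIndicators f g → P f g) → P 0 0 × P 1 0 × P 0 1
    from h = h neither , h first , h second

  -- The weights 7, 1, 6 and the constant 24 solve the dual of the linear
  -- program that maximises the probability of a monochromatic spoke.
  spokes-≤ : ∀ (κ : Vertex → Fin 4) → (∀ i → κ (inner i) ≢ κ (outer i)) →
             tally spokes κ ≤ 24 + tally (hexagons ++ neighbours) κ
  spokes-≤ κ proper = begin
    tally spokes κ
      ≤⟨ indicators (d 0F) (d 1F) (d 2F) (d 3F) (d 4F) (d 5F) ⟩
    24 + (leastPairs (occurrences a (κ ∘ inner)) + leastPairs (occurrences a (κ ∘ outer))
          + coincidences a neighbours κ)
      ≤⟨ ℕ.+-monoʳ-≤ 24 (ℕ.+-mono-≤ (ℕ.+-mono-≤ (leastPairs-≤ a (κ ∘ inner)) (leastPairs-≤ a (κ ∘ outer)))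
                                    (coincidences-≤ a neighbours κ)) ⟩
    24 + (tally (pairs 1 inner inner allPairs) κ + tally (pairs 1 outer outer allPairs) κ
          + tally neighbours κ)
      ≡⟨ ≡.cong (λ n → 24 + (n + tally neighbours κ))
           (tally-++ (pairs 1 inner inner allPairs) (pairs 1 outer outer allPairs) κ) ⟨
    24 + (tally hexagons κ + tally neighbours κ)
      ≡⟨ ≡.cong (24 +_) (tally-++ hexagons neighbours κ) ⟨
    24 + tally (hexagons ++ neighbours) κ   ∎
    where
    open ℕ.≤-Reasoning
    a = κ centre
    d : ∀ i → DisjointIndicators (same a (κ (inner i))) (same a (κ (outer i)))
    d i = same-disjoint a (proper i)
    -- These spell out what `tally spokes κ` and the bound of the next step compute to, with each
    -- `same a _` replaced by an indicator. The inequality is sharp: when the centre agrees with all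
    -- of one hexagon and none of the other, it reads 42 ≤ 24 + 15 + 3.
    charge budget : Vec ℕ 6 → Vec ℕ 6 → ℕ
    charge (f₀ ∷ f₁ ∷ f₂ ∷ f₃ ∷ f₄ ∷ f₅ ∷ []) (g₀ ∷ g₁ ∷ g₂ ∷ g₃ ∷ g₄ ∷ g₅ ∷ []) =
      7 * f₀ + (7 * f₁ + (7 * f₂ + (7 * f₃ + (7 * f₄ + (7 * f₅ +
      (7 * g₀ + (7 * g₁ + (7 * g₂ + (7 * g₃ + (7 * g₄ + (7 * g₅ + 0)))))))))))
    budget (f₀ ∷ f₁ ∷ f₂ ∷ f₃ ∷ f₄ ∷ f₅ ∷ []) (g₀ ∷ g₁ ∷ g₂ ∷ g₃ ∷ g₄ ∷ g₅ ∷ []) = 24 +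
      (leastPairs (f₀ + (f₁ + (f₂ + (f₃ + (f₄ + (f₅ + 0)))))) +
       leastPairs (g₀ + (g₁ + (g₂ + (g₃ + (g₄ + (g₅ + 0)))))) +
      (6 * (f₀ * g₁) + (6 * (f₁ * g₂) + (6 * (f₂ * g₃) + (6 * (f₃ * g₄) + (6 * (f₄ * g₅) +
      (6 * (f₅ * g₀) + (6 * (f₁ * g₀) + (6 * (f₂ * g₁) + (6 * (f₃ * g₂) + (6 * (f₄ * g₃) +
      (6 * (f₅ * g₄) + (6 * (f₀ * g₅) + 0)))))))))))))

    indicators : ∀ {f₀ g₀} → DisjointIndicators f₀ g₀ → ∀ {f₁ g₁} → DisjointIndicators f₁ g₁ → ∀ {f₂ g₂} → DisjointIndicators f₂ g₂ →
      ∀ {f₃ g₃} → DisjointIndicators f₃ g₃ → ∀ {f₄ g₄} → DisjointIndicators f₄ g₄ → ∀ {f₅ g₅} → DisjointIndicators f₅ g₅ →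
      let F = f₀ ∷ f₁ ∷ f₂ ∷ f₃ ∷ f₄ ∷ f₅ ∷ []
          G = g₀ ∷ g₁ ∷ g₂ ∷ g₃ ∷ g₄ ∷ g₅ ∷ []
      in charge F G ≤ budget F G
    indicators = toWitness {a? = disjoint? λ f₀ g₀ → disjoint? λ f₁ g₁ → disjoint? λ f₂ g₂ →
      disjoint? λ f₃ g₃ → disjoint? λ f₄ g₄ → disjoint? λ f₅ g₅ →
      let F = f₀ ∷ f₁ ∷ f₂ ∷ f₃ ∷ f₄ ∷ f₅ ∷ []
          G = g₀ ∷ g₁ ∷ g₂ ∷ g₃ ∷ g₄ ∷ g₅ ∷ []
      in charge F G ℕ.≤? budget F G} _

  All-pairs : ∀ {U V W : Set} (Q : W → W → Set) (φ : V → W) w (f g : U → V) L →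
              All (λ (i , j) → Q (φ (f i)) (φ (g j))) L →
              All (λ (_ , x , y) → Q x y) (relabel φ (pairs w f g L))
  All-pairs Q φ w f g []      []      = []
  All-pairs Q φ w f g (_ ∷ L) (q ∷ h) = q ∷ All-pairs Q φ w f g L h

  same-+ : ∀ {n} (x : Fin n) {y z} → y ≢ z → same x y + same x z ≤ 1
  same-+ x {y} {z} y≢z with x Fin.≟ y | x Fin.≟ z
  ... | yes refl | yes refl = contradiction refl y≢z
  ... | yes _      | no  _      = s≤s z≤n
  ... | no  _      | yes _      = s≤s z≤n
  ... | no  _      | no  _      = z≤n

  same-+-+ : ∀ {n} (x : Fin n) {y z w} → y ≢ z → y ≢ w → z ≢ w →
             same x y + (same x z + same x w) ≤ 1
  same-+-+ x {y} {z} {w} y≢z y≢w z≢w with x Fin.≟ y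
  ... | no  _      = same-+ x z≢w
  ... | yes refl rewrite same-≢ y≢z | same-≢ y≢w = s≤s z≤n

  -- The colours other than `o` number three, so the two-element sets formed by `l`, `l′` and by
  -- `u`, `u′` must meet.
  rectangle : ∀ (o l l′ u u′ : Fin 4) → o ≢ l → o ≢ l′ → o ≢ u → o ≢ u′ → l ≢ l′ → u ≢ u′ →
              1 ≤ 1 * same l u + (1 * same l′ u′ + (1 * same l u′ + (1 * same l′ u + 0)))
  rectangle = toWitness {a? = Fin.all? λ o → Fin.all? λ l → Fin.all? λ l′ → Fin.all? λ u → Fin.all? λ u′ →
    ¬? (o Fin.≟ l) →-dec ¬? (o Fin.≟ l′) →-dec ¬? (o Fin.≟ u) →-dec ¬? (o Fin.≟ u′) →-dec
    ¬? (l Fin.≟ l′) →-dec ¬? (u Fin.≟ u′) →-dec (1 ℕ.≤? _)} _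

-- Ordered-field arithmetic and a ring solver with integer coefficients.

module RealArithmetic (ℝ : CompleteOrderedField) where
  open import Data.Integer.Base as ℤ using (ℤ; +_; -[1+_]; _⊖_; _◃_)
  open CompleteOrderedField ℝ
  open SemiringMult semiring using (×-homo-+; ×1-homo-*)
  open RingProperties ring using (-‿involutive; -‿distribˡ-*; -‿distribʳ-*; -‿+-comm; -0#≈0#)
  open SetoidReasoning setoid

  # : ℕ → Carrier
  # = fromℕ

  -- Interprets the coefficients of the ring solver. Integers have decidable equality by
  -- computation, so the solver can collect and cancel numerical constants.
  fromℤ : ℤ → Carrier
  fromℤ (+ n)    = fromℕ n
  fromℤ -[1+ n ] = - fromℕ (suc n)

  fromℤ-neg : ∀ i → fromℤ (ℤ.- i) ≈ - fromℤ i
  fromℤ-neg (+ zero)  = sym -0#≈0#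
  fromℤ-neg (+ suc n) = refl
  fromℤ-neg -[1+ n ]  = sym (-‿involutive _)

  fromℤ-⊖ : ∀ m n → fromℤ (m ⊖ n) ≈ fromℕ m - fromℕ n
  fromℤ-⊖ m       zero    = sym (trans (+-congˡ -0#≈0#) (+-identityʳ _))
  fromℤ-⊖ zero    (suc n) = sym (+-identityˡ _)
  fromℤ-⊖ (suc m) (suc n) = begin
    fromℤ (suc m ⊖ suc n)                       ≡⟨ ≡.cong fromℤ (ℤ.[1+m]⊖[1+n]≡m⊖n m n) ⟩
    fromℤ (m ⊖ n)                               ≈⟨ fromℤ-⊖ m n ⟩
    fromℕ m - fromℕ n                           ≈⟨ +-congˡ (+-identityˡ _) ⟨
    fromℕ m + (0# - fromℕ n)                    ≈⟨ +-congˡ (+-congʳ (-‿inverseʳ 1#)) ⟨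
    fromℕ m + (1# - 1# - fromℕ n)               ≈⟨ +-congˡ (+-assoc _ _ _) ⟩
    fromℕ m + (1# + (- 1# - fromℕ n))           ≈⟨ +-assoc _ _ _ ⟨
    fromℕ m + 1# + (- 1# - fromℕ n)             ≈⟨ +-cong (+-comm _ _) (-‿+-comm _ _) ⟩
    1# + fromℕ m - (1# + fromℕ n)               ∎

  fromℤ-+ : ∀ i j → fromℤ (i ℤ.+ j) ≈ fromℤ i + fromℤ j
  fromℤ-+ (+ m)    (+ n)    = ×-homo-+ 1# m n
  fromℤ-+ (+ m)    -[1+ n ] = fromℤ-⊖ m (suc n)
  fromℤ-+ -[1+ m ] (+ n)    = trans (fromℤ-⊖ n (suc m)) (+-comm _ _)
  fromℤ-+ -[1+ m ] -[1+ n ] = begin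
    - fromℕ (suc (suc (m ℕ.+ n)))               ≡⟨ ≡.cong (λ k → - fromℕ (suc k)) (ℕ.+-suc m n) ⟨
    - fromℕ (suc m ℕ.+ suc n)                   ≈⟨ -‿cong (×-homo-+ 1# (suc m) (suc n)) ⟩
    - (fromℕ (suc m) + fromℕ (suc n))           ≈⟨ -‿+-comm _ _ ⟨
    - fromℕ (suc m) - fromℕ (suc n)             ∎

  fromℤ-◃ : ∀ n → fromℤ (Sign.- ◃ n) ≈ - fromℕ n
  fromℤ-◃ n = trans (reflexive (≡.cong fromℤ (ℤ.-◃n≡-n n))) (fromℤ-neg (+ n))

  fromℤ-* : ∀ i j → fromℤ (i ℤ.* j) ≈ fromℤ i * fromℤ j
  fromℤ-* (+ m)    (+ n)    = trans (reflexive (≡.cong fromℤ (ℤ.+◃n≡+n (m ℕ.* n)))) (×1-homo-* m n)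
  fromℤ-* (+ m)    -[1+ n ] = trans (fromℤ-◃ (m ℕ.* suc n))
    (trans (-‿cong (×1-homo-* m (suc n))) (-‿distribʳ-* _ _))
  fromℤ-* -[1+ m ] (+ n)    = trans (fromℤ-◃ (suc m ℕ.* n))
    (trans (-‿cong (×1-homo-* (suc m) n)) (-‿distribˡ-* _ _))
  fromℤ-* -[1+ m ] -[1+ n ] = begin
    fromℕ (suc m ℕ.* suc n)                     ≈⟨ ×1-homo-* (suc m) (suc n) ⟩
    fromℕ (suc m) * fromℕ (suc n)               ≈⟨ -‿involutive _ ⟨
    - - (fromℕ (suc m) * fromℕ (suc n))         ≈⟨ -‿cong (-‿distribˡ-* _ _) ⟩
    - (- fromℕ (suc m) * fromℕ (suc n))         ≈⟨ -‿distribʳ-* _ _ ⟩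
    - fromℕ (suc m) * - fromℕ (suc n)           ∎

  fromℤ-homomorphism : ℤ.+-*-rawRing -Raw-AlmostCommutative⟶ fromCommutativeRing commutativeRing
  fromℤ-homomorphism = record
    { ⟦_⟧    = fromℤ
    ; +-homo = fromℤ-+
    ; *-homo = fromℤ-*
    ; -‿homo = fromℤ-neg
    ; 0-homo = refl
    ; 1-homo = +-identityʳ 1#
    }

  fromℤ-≟ : ∀ i j → Maybe (fromℤ i ≈ fromℤ j)
  fromℤ-≟ i j with i ℤ.≟ j
  ... | yes i≡j = just (reflexive (≡.cong fromℤ i≡j))
  ... | no  _   = nothing

  open RingSolver ℤ.+-*-rawRing (fromCommutativeRing commutativeRing) fromℤ-homomorphism fromℤ-≟ public
    using (solve; _:=_; _:+_; _:*_; _:-_; :-_; con; Polynomial)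

  :# : ∀ {m} → ℕ → Polynomial m
  :# n = con (+ n)

  ≤⇒0≤- : ∀ {x y} → x ≤ y → 0# ≤ y - x
  ≤⇒0≤- {x} p = ≤-respˡ-≈ (-‿inverseʳ x) (+-monoˡ-≤ (- x) p)

  -- Most inequalities below are proved in this way: a nonnegative difference `e` is exhibited, and
  -- the equation is left to the ring solver.
  ≤-by : ∀ {x y e} → 0# ≤ e → y ≈ x + e → x ≤ y
  ≤-by {x} {y} {e} p eq = ≤-respˡ-≈ (+-identityˡ x)
    (≤-respʳ-≈ (trans (+-comm e x) (sym eq)) (+-monoˡ-≤ x p))

  0≤-⇒≤ : ∀ {x y} → 0# ≤ y - x → x ≤ y
  0≤-⇒≤ {x} {y} p = ≤-by p (solve 2 (λ x y → y := x :+ (y :- x)) refl x y)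

  +-mono-≤ : ∀ {x y u v} → x ≤ y → u ≤ v → x + u ≤ y + v
  +-mono-≤ {x} {y} {u} {v} p q = ≤-trans (+-monoˡ-≤ u p)
    (≤-respˡ-≈ (+-comm u y) (≤-respʳ-≈ (+-comm v y) (+-monoˡ-≤ y q)))

  0≤+ : ∀ {x y} → 0# ≤ x → 0# ≤ y → 0# ≤ x + y
  0≤+ p q = ≤-respˡ-≈ (+-identityˡ 0#) (+-mono-≤ p q)

  *-monoʳ-≤ : ∀ {x y z} → 0# ≤ z → x ≤ y → z * x ≤ z * y
  *-monoʳ-≤ {x} {y} {z} p q = ≤-by (*-nonNegative p (≤⇒0≤- q))
    (solve 3 (λ x y z → z :* y := z :* x :+ z :* (y :- x)) refl x y z)

  *-mono-≤ : ∀ {x y u v} → 0# ≤ x → 0# ≤ u → x ≤ y → u ≤ v → x * u ≤ y * v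
  *-mono-≤ {x} {y} {u} {v} 0≤x 0≤u p q = ≤-trans (*-monoʳ-≤ 0≤x q)
    (≤-respˡ-≈ (*-comm v x) (≤-respʳ-≈ (*-comm v y) (*-monoʳ-≤ (≤-trans 0≤u q) p)))

  0≤sq : ∀ x → 0# ≤ x * x
  0≤sq x with total 0# x
  ... | inj₁ p = *-nonNegative p p
  ... | inj₂ p = ≤-respʳ-≈ (solve 1 (λ x → (:# 0 :- x) :* (:# 0 :- x) := x :* x) refl x)
                           (*-nonNegative (≤⇒0≤- p) (≤⇒0≤- p))

  0≤1 : 0# ≤ 1#
  0≤1 = ≤-respʳ-≈ (*-identityˡ 1#) (0≤sq 1#)

  0≤fromℕ : ∀ n → 0# ≤ fromℕ n
  0≤fromℕ zero    = ≤-refl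
  0≤fromℕ (suc n) = 0≤+ 0≤1 (0≤fromℕ n)

  fromℕ-mono-≤ : ∀ {m n} → m ℕ.≤ n → fromℕ m ≤ fromℕ n
  fromℕ-mono-≤ {n = n} ℕ.z≤n = 0≤fromℕ n
  fromℕ-mono-≤ (ℕ.s≤s p)     = +-mono-≤ ≤-refl (fromℕ-mono-≤ p)

  fromℕ-suc≉0 : ∀ n → ¬ fromℕ (suc n) ≈ 0#
  fromℕ-suc≉0 n e = 1≉0 (antisym (≤-respʳ-≈ e (≤-by (0≤fromℕ n) refl)) 0≤1)

  *-cancel-zero : ∀ {x y} → ¬ x ≈ 0# → x * y ≈ 0# → y ≈ 0#
  *-cancel-zero {x} {y} x≉0 e = begin
    y                  ≈⟨ *-identityˡ y ⟨
    1# * y             ≈⟨ *-congʳ (⁻¹-inverse x≉0) ⟨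
    x * x ⁻¹ * y       ≈⟨ solve 3 (λ x k y → x :* k :* y := k :* (x :* y)) refl x (x ⁻¹) y ⟩
    x ⁻¹ * (x * y)     ≈⟨ *-congˡ e ⟩
    x ⁻¹ * 0#          ≈⟨ zeroʳ _ ⟩
    0#                 ∎

  sq≈0⇒≈0 : ∀ {x} → x * x ≈ 0# → x ≈ 0#
  sq≈0⇒≈0 {x} e with x ≟ 0#
  ... | yes p = p
  ... | no  q = *-cancel-zero q e

  -- If instead y ≤ x, then monotonicity and antisymmetry force z x = z y, and cancelling the
  -- nonzero `z` gives x = y.
  *-cancel-≤ : ∀ {x y z} → 0# ≤ z → ¬ z ≈ 0# → z * x ≤ z * y → x ≤ y
  *-cancel-≤ {x} {y} {z} 0≤z z≉0 p with total x y
  ... | inj₁ x≤y = x≤y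
  ... | inj₂ y≤x = ≤-reflexive (begin
    x                 ≈⟨ solve 2 (λ x y → x := y :+ (x :- y)) refl x y ⟩
    y + (x - y)       ≈⟨ +-congˡ (*-cancel-zero z≉0 (begin
        z * (x - y)       ≈⟨ solve 3 (λ x y z → z :* (x :- y) := z :* x :- z :* y) refl x y z ⟩
        z * x - z * y     ≈⟨ +-congʳ (antisym p (*-monoʳ-≤ 0≤z y≤x)) ⟩
        z * y - z * y     ≈⟨ -‿inverseʳ _ ⟩
        0#                ∎)) ⟩
    y + 0#            ≈⟨ +-identityʳ y ⟩
    y                 ∎)

  fromℕ-cancel-≤ : ∀ {x y} n → fromℕ (suc n) * x ≤ fromℕ (suc n) * y → x ≤ y
  fromℕ-cancel-≤ n = *-cancel-≤ (0≤fromℕ (suc n)) (fromℕ-suc≉0 n)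

  sq-mono-≤ : ∀ {x y} → 0# ≤ x → x ≤ y → x * x ≤ y * y
  sq-mono-≤ p q = *-mono-≤ p p q q

  sq-cancel-≤ : ∀ {x y} → 0# ≤ y → x * x ≤ y * y → x ≤ y
  sq-cancel-≤ {x} {y} 0≤y p with total x y
  ... | inj₁ x≤y = x≤y
  ... | inj₂ y≤x = ≤-reflexive (begin
    x              ≈⟨ solve 2 (λ x y → x := y :+ (x :- y)) refl x y ⟩
    y + (x - y)    ≈⟨ +-congˡ (sq≈0⇒≈0 (antisym bound (0≤sq _))) ⟩
    y + 0#         ≈⟨ +-identityʳ y ⟩
    y              ∎)
    where
    -- Here x² - y² = (x - y)² + 2y(x - y), where the last term is nonnegative and the left side is
    -- at most 0.
    bound : (x - y) * (x - y) ≤ 0#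
    bound = ≤-trans
      (≤-by (0≤+ (*-nonNegative 0≤y (≤⇒0≤- y≤x)) (*-nonNegative 0≤y (≤⇒0≤- y≤x))) refl)
      (≤-respˡ-≈ (solve 2 (λ x y → x :* x :- y :* y
                    := (x :- y) :* (x :- y) :+ (y :* (x :- y) :+ y :* (x :- y))) refl x y)
        (≤-respʳ-≈ (-‿inverseʳ (y * y)) (+-monoˡ-≤ (- (y * y)) p)))

  *-/-cancel : ∀ x {y} → ¬ y ≈ 0# → y * (x / y) ≈ x
  *-/-cancel x {y} y≉0 = begin
    y * (x * y ⁻¹)   ≈⟨ solve 3 (λ x y k → y :* (x :* k) := x :* (y :* k)) refl x y (y ⁻¹) ⟩
    x * (y * y ⁻¹)   ≈⟨ *-congˡ (⁻¹-inverse y≉0) ⟩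
    x * 1#           ≈⟨ *-identityʳ x ⟩
    x                ∎

-- Rotations of the plane and congruence of segments.

module PlaneGeometry (ℝ : CompleteOrderedField) where
  open CompleteOrderedField ℝ
  open RealArithmetic ℝ
  open SquareRoot ℝ using (√_; √-nonNegative; √-square; √-cong)
  open Plane ℝ
  open SetoidReasoning setoid

  -- Squared distances avoid square roots, so that metric statements become polynomial identities.
  sqDist : Point → Point → Carrier
  sqDist (a , b) (c , d) = (a - c) * (a - c) + (b - d) * (b - d)

  0≤sqDist : ∀ A B → 0# ≤ sqDist A B
  0≤sqDist (a , b) (c , d) = 0≤+ (0≤sq (a - c)) (0≤sq (b - d))

  dist²≈sqDist : ∀ A B → dist A B * dist A B ≈ sqDist A B
  dist²≈sqDist A B = √-square (0≤sqDist A B)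

  √1≈1 : √ 1# ≈ 1#
  √1≈1 = antisym (sq-cancel-≤ 0≤1 (≤-reflexive e)) (sq-cancel-≤ (√-nonNegative 1#) (≤-reflexive (sym e)))
    where
    e : √ 1# * √ 1# ≈ 1# * 1#
    e = trans (√-square 0≤1) (sym (*-identityˡ 1#))

  sqDist≈1⇒dist≈1 : ∀ A B → sqDist A B ≈ 1# → dist A B ≈ 1#
  sqDist≈1⇒dist≈1 A B e = trans (√-cong e) √1≈1

  -- z ↦ P′ + (c + i s) (z - P)
  rotate : Carrier → Carrier → Point → Point → Point → Point
  rotate c s (p , q) (p′ , q′) (x , y) =
    p′ + (c * (x - p) - s * (y - q)) , q′ + (s * (x - p) + c * (y - q))

  rotate-cong : ∀ c s P P′ {A B} → A ℂ.≈ B → rotate c s P P′ A ℂ.≈ rotate c s P P′ B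
  rotate-cong c s P P′ (e , f) =
    +-congˡ (+-cong (*-congˡ (+-congʳ e)) (-‿cong (*-congˡ (+-congʳ f)))) ,
    +-congˡ (+-cong (*-congˡ (+-congʳ e)) (*-congˡ (+-congʳ f)))

  -- The two sines are only required to be opposite, so that the same proof serves for `s`, `- s`
  -- and for `- s`, `s`, that is, for both composites of a rotation with its inverse.
  rotate-inverse : ∀ c s s′ → s + s′ ≈ 0# → c * c + s * s ≈ 1# → ∀ P P′ A →
                   rotate c s P P′ (rotate c s′ P′ P A) ℂ.≈ A
  rotate-inverse c s s′ opposite unit (p , q) (p′ , q′) (x , y) =
    (begin
      p′ + (c * (p + (c * X - s′ * Y) - p) - s * (q + (s′ * X + c * Y) - q))
        ≈⟨ solve 8 (λ c s s′ p q p′ X Y →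
             p′ :+ (c :* (p :+ (c :* X :- s′ :* Y) :- p) :- s :* (q :+ (s′ :* X :+ c :* Y) :- q))
             := p′ :+ ((c :* c :+ s :* s) :* X :- (s :+ s′) :* (s :* X :+ c :* Y)))
             refl c s s′ p q p′ X Y ⟩
      p′ + ((c * c + s * s) * X - (s + s′) * (s * X + c * Y))
        ≈⟨ +-congˡ (+-cong (*-congʳ unit) (-‿cong (*-congʳ opposite))) ⟩
      p′ + (1# * X - 0# * (s * X + c * Y))
        ≈⟨ +-congˡ (+-cong (*-identityˡ X) (-‿cong (zeroˡ _))) ⟩
      p′ + (x - p′ - 0#)
        ≈⟨ solve 2 (λ x p → p :+ (x :- p :- :# 0) := x) refl x p′ ⟩
      x ∎) ,
    (begin
      q′ + (s * (p + (c * X - s′ * Y) - p) + c * (q + (s′ * X + c * Y) - q))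
        ≈⟨ solve 8 (λ c s s′ p q q′ X Y →
             q′ :+ (s :* (p :+ (c :* X :- s′ :* Y) :- p) :+ c :* (q :+ (s′ :* X :+ c :* Y) :- q))
             := q′ :+ ((c :* c :+ s :* s) :* Y :+ (s :+ s′) :* (c :* X :- s :* Y)))
             refl c s s′ p q q′ X Y ⟩
      q′ + ((c * c + s * s) * Y + (s + s′) * (c * X - s * Y))
        ≈⟨ +-congˡ (+-cong (*-congʳ unit) (*-congʳ opposite)) ⟩
      q′ + (1# * Y + 0# * (c * X - s * Y))
        ≈⟨ +-congˡ (+-cong (*-identityˡ Y) (zeroˡ _)) ⟩
      q′ + (y - q′ + 0#)
        ≈⟨ solve 2 (λ y q → q :+ (y :- q :+ :# 0) := y) refl y q′ ⟩
      y ∎)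
    where
    X = x - p′
    Y = y - q′

  rotate-isometric : ∀ c s → c * c + s * s ≈ 1# → ∀ P P′ A B →
                     sqDist (rotate c s P P′ A) (rotate c s P P′ B) ≈ sqDist A B
  rotate-isometric c s unit (p , q) (p′ , q′) (x , y) (u , v) = begin
    sqDist (rotate c s (p , q) (p′ , q′) (x , y)) (rotate c s (p , q) (p′ , q′) (u , v))
      ≈⟨ +-cong (*-cong first first) (*-cong second second) ⟩
    (c * X - s * Y) * (c * X - s * Y) + (s * X + c * Y) * (s * X + c * Y)
      ≈⟨ solve 4 (λ c s X Y →
           (c :* X :- s :* Y) :* (c :* X :- s :* Y) :+ (s :* X :+ c :* Y) :* (s :* X :+ c :* Y)
           := (c :* c :+ s :* s) :* (X :* X :+ Y :* Y)) refl c s X Y ⟩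
    (c * c + s * s) * (X * X + Y * Y)   ≈⟨ *-congʳ unit ⟩
    1# * (X * X + Y * Y)                ≈⟨ *-identityˡ _ ⟩
    X * X + Y * Y                       ∎
    where
    X = x - u
    Y = y - v
    first : p′ + (c * (x - p) - s * (y - q)) - (p′ + (c * (u - p) - s * (v - q))) ≈ c * X - s * Y
    first = solve 9 (λ c s p q p′ x y u v →
      p′ :+ (c :* (x :- p) :- s :* (y :- q)) :- (p′ :+ (c :* (u :- p) :- s :* (v :- q)))
      := c :* (x :- u) :- s :* (y :- v)) refl c s p q p′ x y u v
    second : q′ + (s * (x - p) + c * (y - q)) - (q′ + (s * (u - p) + c * (v - q))) ≈ s * X + c * Y
    second = solve 9 (λ c s p q q′ x y u v →
      q′ :+ (s :* (x :- p) :+ c :* (y :- q)) :- (q′ :+ (s :* (u :- p) :+ c :* (v :- q)))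
      := s :* (x :- u) :+ c :* (y :- v)) refl c s p q q′ x y u v

  rotation : ∀ c s → c * c + s * s ≈ 1# → Point → Point → Isometry
  rotation c s unit P P′ = record
    { bijection = record
      { to        = rotate c s P P′
      ; from      = rotate c (- s) P′ P
      ; to-cong   = rotate-cong c s P P′
      ; from-cong = rotate-cong c (- s) P′ P
      ; inverse   = (λ {A} e → ℂ.trans (rotate-cong c s P P′ e)
                       (rotate-inverse c s (- s) (-‿inverseʳ s) unit P P′ A))
                  , (λ {A} e → ℂ.trans (rotate-cong c (- s) P′ P e)
                       (rotate-inverse c (- s) s (-‿inverseˡ s) unit⁻ P′ P A))
      }
    ; isometric = λ A B → √-cong (rotate-isometric c s unit P P′ A B)
    }
    where
    unit⁻ : c * c + - s * - s ≈ 1#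
    unit⁻ = trans (+-congˡ (solve 1 (λ s → :- s :* :- s := s :* s) refl s)) unit

  rotation-centre : ∀ c s P P′ → rotate c s P P′ P ℂ.≈ P′
  rotation-centre c s (p , q) (p′ , q′) =
    solve 5 (λ c s p q p′ → p′ :+ (c :* (p :- p) :- s :* (q :- q)) := p′) refl c s p q p′ ,
    solve 5 (λ c s p q q′ → q′ :+ (s :* (p :- p) :+ c :* (q :- q)) := q′) refl c s p q q′

  sqDist≈0⇒≈ : ∀ A B → sqDist A B ≈ 0# → A ℂ.≈ B
  sqDist≈0⇒≈ (a , b) (c , d) e =
    close (sq≈0⇒≈0 (antisym (≤-by (0≤sq (b - d)) (sym e)) (0≤sq (a - c)))) ,
    close (sq≈0⇒≈0 (antisym (≤-by (0≤sq (a - c)) (trans (sym e) (+-comm _ _))) (0≤sq (b - d))))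
    where
    close : ∀ {x y} → x - y ≈ 0# → x ≈ y
    close {x} {y} e = trans (solve 2 (λ x y → x := y :+ (x :- y)) refl x y)
      (trans (+-congˡ e) (+-identityʳ y))

  -- Multiplication by w′ w̄ / |w|², where w = B - A and w′ = B′ - A′.
  transport : ∀ A B A′ B′ → sqDist A B ≈ sqDist A′ B′ →
              ∃ λ T → Isometry.to T A ℂ.≈ A′ × Isometry.to T B ℂ.≈ B′
  transport A@(a , b) B@(c , d) A′@(a′ , b′) B′@(c′ , d′) e with sqDist A B ≟ 0#
  -- A vanishing `w` cannot be divided by. Then A = B and A′ = B′, and a translation suffices.
  ... | yes A≡B = T , rotation-centre 1# 0# A A′ ,
        ℂ.trans (Isometry.to-cong T {B} {A} (ℂ.sym {A} {B} (sqDist≈0⇒≈ A B A≡B)))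
          (ℂ.trans (rotation-centre 1# 0# A A′) (sqDist≈0⇒≈ A′ B′ (trans (sym e) A≡B)))
    where
    T = rotation 1# 0# (trans (+-cong (*-identityˡ 1#) (zeroˡ 0#)) (+-identityʳ 1#)) A A′
  ... | no A≢B = rotation C S unit A A′ , rotation-centre C S A A′ , (first , second)
    where
    u = a - c
    v = b - d
    u′ = a′ - c′
    v′ = b′ - d′
    n = u * u + v * v
    k = n ⁻¹
    C = (u * u′ + v * v′) * k
    S = (u * v′ - v * u′) * k
    nk≈1 : n * k ≈ 1#
    nk≈1 = ⁻¹-inverse A≢B
    unit : C * C + S * S ≈ 1#
    -- The Brahmagupta-Fibonacci identity: the squares of the two numerators add up to the product
    -- of the squared lengths.
    unit = begin
      C * C + S * S
        ≈⟨ solve 5 (λ u v u′ v′ k →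
             (u :* u′ :+ v :* v′) :* k :* ((u :* u′ :+ v :* v′) :* k)
             :+ (u :* v′ :- v :* u′) :* k :* ((u :* v′ :- v :* u′) :* k)
             := (u :* u :+ v :* v) :* k :* ((u′ :* u′ :+ v′ :* v′) :* k)) refl u v u′ v′ k ⟩
      n * k * ((u′ * u′ + v′ * v′) * k)   ≈⟨ *-congˡ (*-congʳ e) ⟨
      n * k * (n * k)                     ≈⟨ *-cong nk≈1 nk≈1 ⟩
      1# * 1#                             ≈⟨ *-identityˡ 1# ⟩
      1#                                  ∎
    first : a′ + (C * (c - a) - S * (d - b)) ≈ c′
    first = begin
      a′ + (C * (c - a) - S * (d - b))
        ≈⟨ solve 7 (λ C S a b c d a′ → a′ :+ (C :* (c :- a) :- S :* (d :- b))
             := a′ :- (C :* (a :- c) :- S :* (b :- d))) refl C S a b c d a′ ⟩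
      a′ - (C * u - S * v)
        ≈⟨ +-congˡ (-‿cong (solve 5 (λ u v u′ v′ k →
             (u :* u′ :+ v :* v′) :* k :* u :- (u :* v′ :- v :* u′) :* k :* v
             := (u :* u :+ v :* v) :* k :* u′) refl u v u′ v′ k)) ⟩
      a′ - n * k * u′       ≈⟨ +-congˡ (-‿cong (trans (*-congʳ nk≈1) (*-identityˡ u′))) ⟩
      a′ - (a′ - c′)        ≈⟨ solve 2 (λ a c → a :- (a :- c) := c) refl a′ c′ ⟩
      c′                    ∎
    second : b′ + (S * (c - a) + C * (d - b)) ≈ d′
    second = begin
      b′ + (S * (c - a) + C * (d - b))
        ≈⟨ solve 7 (λ C S a b c d b′ → b′ :+ (S :* (c :- a) :+ C :* (d :- b))
             := b′ :- (S :* (a :- c) :+ C :* (b :- d))) refl C S a b c d b′ ⟩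
      b′ - (S * u + C * v)
        ≈⟨ +-congˡ (-‿cong (solve 5 (λ u v u′ v′ k →
             (u :* v′ :- v :* u′) :* k :* u :+ (u :* u′ :+ v :* v′) :* k :* v
             := (u :* u :+ v :* v) :* k :* v′) refl u v u′ v′ k)) ⟩
      b′ - n * k * v′       ≈⟨ +-congˡ (-‿cong (trans (*-congʳ nk≈1) (*-identityˡ v′))) ⟩
      b′ - (b′ - d′)        ≈⟨ solve 2 (λ a c → a :- (a :- c) := c) refl b′ d′ ⟩
      d′                    ∎

-- Probabilities and expectations for the random colouring.

module RandomColouring (ℝ : CompleteOrderedField) where
  open CompleteOrderedField ℝ
  open RealArithmetic ℝ
  open PlaneGeometry ℝ
  open Plane ℝ
  open Tally
  open SemiringMult semiring using (×-homo-+)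

  module Probability (c₀ : ProperColouring) (P : InvariantProbability ℝ S₄×E₂) where
    open ProperColouring c₀
    open Isometry using (to; from; to-cong; from-cong; strictlyInverseˡ; strictlyInverseʳ)
    open Group S₄×E₂ using () renaming (Carrier to G)
    open Subsets S₄×E₂
    open InvariantProbability P
    open SetoidReasoning setoid

    c : G → Point → Colour
    c = randomColouring c₀

    p : Point → Point → Carrier
    p = monochromaticity c₀ P

    c-cong : ∀ g {A B} → A ℂ.≈ B → c g A ≡ c g B
    c-cong (σ , T) A≈B = ≡.cong (σ ⟨$⟩ʳ_) (colour-cong (from-cong T A≈B))

    p-cong : ∀ {A A′ B B′} → A ℂ.≈ A′ → B ℂ.≈ B′ → p A B ≈ p A′ B′
    p-cong {A} {A′} {B} {B′} a b = μ-cong λ g →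
      (λ e → ≡.trans (≡.sym (c-cong g {A} {A′} a)) (≡.trans e (c-cong g {B} {B′} b))) ,
      (λ e → ≡.trans (c-cong g {A} {A′} a) (≡.trans e (≡.sym (c-cong g {B} {B′} b))))

    -- The colouring of T ∘ H at T A is that of H at A. Hence the event for the moved pair is the
    -- left translate by (id, T) of the event for the original pair, and `leftInvariant` applies.
    p-isometry : ∀ T A B → p (to T A) (to T B) ≈ p A B
    p-isometry T A B = trans (μ-cong moved) (leftInvariant (Perm.id , T) (monochromatic c₀ A B))
      where
      moved : monochromatic c₀ (to T A) (to T B) ≐ translate (Perm.id , T) (monochromatic c₀ A B)
      moved (σ , H) =
        (λ e → (σ , Group._∙_ euclideanGroup (Group._⁻¹ euclideanGroup T) H) , e ,
               (λ _ → ≡.refl) , λ X → ℂ.sym (strictlyInverseˡ T (to H X))) ,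
        λ { ((τ , X) , e , h≈gx) →
          let back = λ Y → ≡.cong (τ ⟨$⟩ʳ_) (colour-cong (from-cong X (strictlyInverseʳ T Y)))
              product = Group._∙_ S₄×E₂ (Perm.id , T) (τ , X)
          in mem-resp (monochromatic c₀ (to T A) (to T B)) {product} {σ , H}
               (Group.sym S₄×E₂ {σ , H} {product} h≈gx)
               (≡.trans (back A) (≡.trans e (≡.sym (back B)))) }

    -- This makes p a function of the distance alone, because congruent segments are related by an
    -- isometry.
    p-sqDist : ∀ {A B A′ B′} → sqDist A B ≈ sqDist A′ B′ → p A B ≈ p A′ B′
    p-sqDist {A} {B} {A′} {B′} e with transport A B A′ B′ e
    ... | T , TA≈A′ , TB≈B′ = trans (sym (p-isometry T A B)) (p-cong TA≈A′ TB≈B′)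

    c-proper : ∀ {A B} → sqDist A B ≈ 1# → ∀ g → c g A ≢ c g B
    c-proper {A} {B} e g@(σ , T) eq = proper (from T A) (from T B)
      (sqDist≈1⇒dist≈1 (from T A) (from T B) (trans fromSq e))
      (≡.trans (≡.sym (Perm.inverseˡ σ)) (≡.trans (≡.cong (σ ⟨$⟩ˡ_) eq) (Perm.inverseˡ σ)))
      where
      fromSq : sqDist (from T A) (from T B) ≈ sqDist A B
      fromSq = begin
        sqDist (from T A) (from T B)                         ≈⟨ dist²≈sqDist (from T A) (from T B) ⟨
        dist (from T A) (from T B) * dist (from T A) (from T B)   ≈⟨ *-cong fromDist fromDist ⟩
        dist A B * dist A B                                  ≈⟨ dist²≈sqDist A B ⟩
        sqDist A B                                           ∎
        where fromDist = Isometry.isometric (Group._⁻¹ euclideanGroup T) A B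

    infixl 7 _∩_ _∖_
    _∩_ _∖_ : Subset → Subset → Subset
    E ∩ F = record
      { mem      = λ g → mem E g × mem F g
      ; mem-resp = λ {g} {h} e (x , y) → mem-resp E {g} {h} e x , mem-resp F {g} {h} e y
      }
    E ∖ F = record
      { mem      = λ g → mem E g × ¬ mem F g
      ; mem-resp = λ {g} {h} e (x , y) →
          mem-resp E {g} {h} e x , λ z → y (mem-resp F {h} {g} (Group.sym S₄×E₂ {g} {h} e) z)
      }

    -- An empty `E` is disjoint from itself and E ∪ E = E, so additivity gives μ E = μ E + μ E.
    μ-empty : ∀ E → (∀ g → ¬ mem E g) → μ E ≈ 0#
    μ-empty E empty = begin
      μ E                   ≈⟨ solve 1 (λ x → x := x :+ x :- x) refl (μ E) ⟩
      μ E + μ E - μ E       ≈⟨ +-congʳ (additive E E λ g (x , _) → empty g x) ⟨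
      μ (E ∪ E) - μ E       ≈⟨ +-congʳ (μ-cong λ g → [ (λ x → x) , (λ x → x) ]′ , inj₁) ⟩
      μ E - μ E             ≈⟨ -‿inverseʳ (μ E) ⟩
      0#                    ∎

    -- The two pieces are described by membership, rather than fixed as intersection and difference
    -- with `E`, because `totalOn-split` needs the intersections taken in another order.
    μ-split : ∀ E {F F₁ F₂} → (∀ g → Dec (mem E g)) →
              (∀ g → (mem F g × mem E g → mem F₁ g) × (mem F₁ g → mem F g × mem E g)) →
              (∀ g → (mem F g × ¬ mem E g → mem F₂ g) × (mem F₂ g → mem F g × ¬ mem E g)) →
              μ F ≈ μ F₁ + μ F₂
    μ-split E {F} {F₁} {F₂} E? inside outside = trans
      (μ-cong {F} {F₁ ∪ F₂} λ g → split g , [ (λ x → proj₁ (proj₂ (inside g) x))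
                                            , (λ x → proj₁ (proj₂ (outside g) x)) ]′)
      (additive F₁ F₂ λ g (x , y) → proj₂ (proj₂ (outside g) y) (proj₂ (proj₂ (inside g) x)))
      where
      split : ∀ g → mem F g → mem F₁ g ⊎ mem F₂ g
      split g x with E? g
      ... | yes y = inj₁ (proj₁ (inside g) (x , y))
      ... | no  y = inj₂ (proj₁ (outside g) (x , y))

    totalOn : Subset → WeightedPairs Point → Carrier
    totalOn S []                = 0#
    totalOn S ((w , A , B) ∷ L) = fromℕ w * μ (S ∩ monochromatic c₀ A B) + totalOn S L

    monochromatic? : ∀ A B g → Dec (mem (monochromatic c₀ A B) g)
    monochromatic? A B g = c g A Fin.≟ c g B

    totalOn-split : ∀ S E → (∀ g → Dec (mem E g)) → ∀ L →
                    totalOn S L ≈ totalOn (S ∩ E) L + totalOn (S ∖ E) L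
    totalOn-split S E E? []                = sym (+-identityʳ 0#)
    totalOn-split S E E? ((w , A , B) ∷ L) = trans
      (+-cong (*-congˡ (μ-split E {S ∩ M} {S ∩ E ∩ M} {S ∖ E ∩ M} E?
                (λ g → (λ ((s , m) , e) → (s , e) , m) , (λ ((s , e) , m) → (s , m) , e))
                (λ g → (λ ((s , m) , e) → (s , e) , m) , (λ ((s , e) , m) → (s , m) , e))))
              (totalOn-split S E E? L))
      (solve 5 (λ w m n t u → w :* (m :+ n) :+ (t :+ u) := w :* m :+ t :+ (w :* n :+ u)) refl
        (fromℕ w) (μ (S ∩ E ∩ M)) (μ (S ∖ E ∩ M)) (totalOn (S ∩ E) L) (totalOn (S ∖ E) L))
      where M = monochromatic c₀ A B

    -- The integral over `S` of `a + tally L`, written as a finite sum. The number `a` collects the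
    -- weights of pairs already known to be monochromatic on `S`.
    value : ℕ → Subset → WeightedPairs Point → Carrier
    value a S L = fromℕ a * μ S + totalOn S L

    value-split : ∀ a S A B L → let E = monochromatic c₀ A B in
                  value a S L ≈ value a (S ∩ E) L + value a (S ∖ E) L
    value-split a S A B L = trans
      (+-cong (*-congˡ (μ-split E {S} {S ∩ E} {S ∖ E} (monochromatic? A B)
                (λ g → (λ x → x) , (λ x → x)) (λ g → (λ x → x) , (λ x → x))))
              (totalOn-split S E (monochromatic? A B) L))
      (solve 5 (λ a m n t u → a :* (m :+ n) :+ (t :+ u) := a :* m :+ t :+ (a :* n :+ u)) refl
        (fromℕ a) (μ (S ∩ E)) (μ (S ∖ E)) (totalOn (S ∩ E) L) (totalOn (S ∖ E) L))
      where E = monochromatic c₀ A B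

    -- Where the first pair is monochromatic its weight moves into the constant; elsewhere it
    -- contributes nothing.
    value-∷ : ∀ a S w A B L → let E = monochromatic c₀ A B in
              value a S ((w , A , B) ∷ L) ≈ value (a ℕ.+ w) (S ∩ E) L + value a (S ∖ E) L
    value-∷ a S w A B L = begin
      fromℕ a * μ S + (fromℕ w * m + totalOn S L)
        ≈⟨ solve 3 (λ x y t → x :+ (y :+ t) := y :+ (x :+ t)) refl
             (fromℕ a * μ S) (fromℕ w * m) (totalOn S L) ⟩
      fromℕ w * m + value a S L
        ≈⟨ +-congˡ (value-split a S A B L) ⟩
      fromℕ w * m + (fromℕ a * m + t + value a (S ∖ E) L)
        ≈⟨ solve 5 (λ a w m t v → w :* m :+ (a :* m :+ t :+ v) := (a :+ w) :* m :+ t :+ v) refl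
             (fromℕ a) (fromℕ w) m t (value a (S ∖ E) L) ⟩
      (fromℕ a + fromℕ w) * m + t + value a (S ∖ E) L
        ≈⟨ +-congʳ (+-congʳ (*-congʳ (×-homo-+ 1# a w))) ⟨
      value (a ℕ.+ w) (S ∩ E) L + value a (S ∖ E) L     ∎
      where
      E = monochromatic c₀ A B
      m = μ (S ∩ E)
      t = totalOn (S ∩ E) L

    tally-≡ : ∀ {A B} g a w L → c g A ≡ c g B →
              a ℕ.+ tally ((w , A , B) ∷ L) (c g) ≡ a ℕ.+ w ℕ.+ tally L (c g)
    tally-≡ g a w L e rewrite same-≡ e | ℕ.*-identityʳ w = ≡.sym (ℕ.+-assoc a w _)

    tally-≢ : ∀ {A B} g a w L → c g A ≢ c g B →
              a ℕ.+ tally ((w , A , B) ∷ L) (c g) ≡ a ℕ.+ tally L (c g)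
    tally-≢ g a w L e rewrite same-≢ e | ℕ.*-zeroʳ w = ≡.refl

    -- S is split by the listed events until both tallies are constant on it.
    tally-≤⇒value-≤ : ∀ S a b L R →
      (∀ g → mem S g → a ℕ.+ tally L (c g) ℕ.≤ b ℕ.+ tally R (c g)) → value a S L ≤ value b S R
    tally-≤⇒value-≤ S a b [] [] bound with a ℕ.≤? b
    ... | yes a≤b = +-mono-≤ (*-mono-≤ (0≤fromℕ a) (nonNegative S) (fromℕ-mono-≤ a≤b) ≤-refl) ≤-refl
    -- With both lists exhausted, an element of `S` would yield a ≤ b. Hence `S` is empty, and both
    -- sides vanish.
    ... | no  a≰b = ≤-reflexive (+-congʳ (trans (vanish a) (sym (vanish b))))
      where
      vanish : ∀ n → fromℕ n * μ S ≈ 0#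
      vanish n = trans (*-congˡ (μ-empty S λ g x → a≰b
        (≡.subst₂ ℕ._≤_ (ℕ.+-identityʳ a) (ℕ.+-identityʳ b) (bound g x)))) (zeroʳ _)
    tally-≤⇒value-≤ S a b [] ((w , A , B) ∷ R) bound =
      ≤-respˡ-≈ (sym (value-split a S A B []))
        (≤-respʳ-≈ (sym (value-∷ b S w A B R))
          (+-mono-≤
            (tally-≤⇒value-≤ (S ∩ monochromatic c₀ A B) a (b ℕ.+ w) [] R λ g (s , e) →
              ℕ.≤-trans (bound g s) (ℕ.≤-reflexive (tally-≡ g b w R e)))
            (tally-≤⇒value-≤ (S ∖ monochromatic c₀ A B) a b [] R λ g (s , e) →
              ℕ.≤-trans (bound g s) (ℕ.≤-reflexive (tally-≢ {A} {B} g b w R e)))))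
    tally-≤⇒value-≤ S a b ((w , A , B) ∷ L) R bound =
      ≤-respˡ-≈ (sym (value-∷ a S w A B L))
        (≤-respʳ-≈ (sym (value-split b S A B R))
          (+-mono-≤
            (tally-≤⇒value-≤ (S ∩ monochromatic c₀ A B) (a ℕ.+ w) b L R λ g (s , e) →
              ℕ.≤-trans (ℕ.≤-reflexive (≡.sym (tally-≡ g a w L e))) (bound g s))
            (tally-≤⇒value-≤ (S ∖ monochromatic c₀ A B) a b L R λ g (s , e) →
              ℕ.≤-trans (ℕ.≤-reflexive (≡.sym (tally-≢ {A} {B} g a w L e))) (bound g s))))

    expected : WeightedPairs Point → Carrier
    expected []                = 0#
    expected ((w , A , B) ∷ L) = fromℕ w * p A B + expected L

    value-whole : ∀ a L → value a whole L ≈ fromℕ a + expected L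
    value-whole a L = +-cong (trans (*-congˡ normalised) (*-identityʳ _)) (totalOn-whole L)
      where
      totalOn-whole : ∀ L → totalOn whole L ≈ expected L
      totalOn-whole []                = refl
      totalOn-whole ((w , A , B) ∷ L) =
        +-cong (*-congˡ (μ-cong λ g → proj₂ , λ x → tt , x)) (totalOn-whole L)

    -- Monotonicity of the expectation. All combinatorial facts about colourings reach the
    -- probabilities through this inequality.
    expectation-≤ : ∀ a b L R → (∀ g → a ℕ.+ tally L (c g) ℕ.≤ b ℕ.+ tally R (c g)) →
                    fromℕ a + expected L ≤ fromℕ b + expected R
    expectation-≤ a b L R bound = ≤-respˡ-≈ (value-whole a L) (≤-respʳ-≈ (value-whole b R)
      (tally-≤⇒value-≤ whole a b L R λ g _ → bound g))

    weight : WeightedPairs Point → ℕ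
    weight []            = 0
    weight ((w , _) ∷ L) = w ℕ.+ weight L

    expected-≤ : ∀ {q L} → All (λ (_ , A , B) → p A B ≤ q) L → expected L ≤ fromℕ (weight L) * q
    expected-≤ {q} []                        = ≤-reflexive (sym (zeroˡ q))
    expected-≤ {q} {(w , _) ∷ L} (pAB≤q ∷ h) =
      ≤-respʳ-≈ (trans (sym (distribʳ q _ _)) (*-congʳ (sym (×-homo-+ 1# w (weight L)))))
        (+-mono-≤ (*-monoʳ-≤ (0≤fromℕ w) pAB≤q) (expected-≤ h))

    expected-≥ : ∀ {q L} → All (λ (_ , A , B) → q ≤ p A B) L → fromℕ (weight L) * q ≤ expected L
    expected-≥ {q} []                        = ≤-reflexive (zeroˡ q)
    expected-≥ {q} {(w , _) ∷ L} (q≤pAB ∷ h) =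
      ≤-respˡ-≈ (trans (sym (distribʳ q _ _)) (*-congʳ (sym (×-homo-+ 1# w (weight L)))))
        (+-mono-≤ (*-monoʳ-≤ (0≤fromℕ w) q≤pAB) (expected-≥ h))

    expected-++ : ∀ L R → expected (L ++ R) ≈ expected L + expected R
    expected-++ []      R = sym (+-identityˡ _)
    expected-++ (x ∷ L) R = trans (+-congˡ (expected-++ L R)) (sym (+-assoc _ _ _))

-- Coordinates and distances in a pair of concentric regular hexagons.

module Hexagons (ℝ : CompleteOrderedField) where
  open CompleteOrderedField ℝ
  open RealArithmetic ℝ
  open PlaneGeometry ℝ
  open SquareRoot ℝ using (√_; √-nonNegative; √-square)
  open Plane ℝ
  open Tally
  open SetoidReasoning setoid

  infixl 6 _-ᵥ_
  infix  8 -ᵥ_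
  _-ᵥ_ : Point → Point → Point
  (a , b) -ᵥ (c , d) = a - c , b - d

  -ᵥ_ : Point → Point
  -ᵥ (a , b) = - a , - b

  O : Point
  O = 0# , 0#

  -- If Q is P turned by 60° about O, these are the six turns of P: with ω = e^{iπ/3} one has ω² = ω
  -- - 1 and ω³ = -1. Coordinates are thus linear in P and Q, without any trigonometric constants.
  hexagon : Point → Point → Fin 6 → Point
  hexagon P Q 0F = P
  hexagon P Q 1F = Q
  hexagon P Q 2F = Q -ᵥ P
  hexagon P Q 3F = -ᵥ P
  hexagon P Q 4F = -ᵥ Q
  hexagon P Q 5F = P -ᵥ Q

  place : Point → Point → Point → Point → Vertex → Point
  place P Q P′ Q′ centre    = O
  place P Q P′ Q′ (inner i) = hexagon P Q i
  place P Q P′ Q′ (outer i) = hexagon P′ Q′ i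

  -- The solver counterpart of `sqDist O`, as `sqDist′` is that of `sqDist`.
  norm² : ∀ {m} → Polynomial m → Polynomial m → Polynomial m
  norm² x y = (:# 0 :- x) :* (:# 0 :- x) :+ (:# 0 :- y) :* (:# 0 :- y)

  sqDist′ : ∀ {m} → Polynomial m → Polynomial m → Polynomial m → Polynomial m → Polynomial m
  sqDist′ a b c d = (a :- c) :* (a :- c) :+ (b :- d) :* (b :- d)

  module Equilateral {X : Carrier} (P Q : Point)
    (OP : sqDist O P ≈ X) (OQ : sqDist O Q ≈ X) (PQ : sqDist P Q ≈ X) where

    private
      a = proj₁ P
      b = proj₂ P
      c = proj₁ Q
      d = proj₂ Q

    centre-vertex : ∀ i → sqDist O (hexagon P Q i) ≈ X
    centre-vertex 0F = OP
    centre-vertex 1F = OQ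
    centre-vertex 2F = trans (solve 4 (λ a b c d → norm² (c :- a) (d :- b) := sqDist′ a b c d) refl a b c d) PQ
    centre-vertex 3F = trans (solve 2 (λ a b → norm² (:- a) (:- b) := norm² a b) refl a b) OP
    centre-vertex 4F = trans (solve 2 (λ a b → norm² (:- a) (:- b) := norm² a b) refl c d) OQ
    centre-vertex 5F = trans (solve 4 (λ a b c d → norm² (a :- c) (b :- d) := sqDist′ a b c d) refl a b c d) PQ

    side : All (λ (i , j) → sqDist (hexagon P Q i) (hexagon P Q j) ≈ X) sides
    side = PQ
      ∷ trans (solve 4 (λ a b c d → sqDist′ c d (c :- a) (d :- b) := norm² a b) refl a b c d) OP
      ∷ trans (solve 4 (λ a b c d → sqDist′ (c :- a) (d :- b) (:- a) (:- b) := norm² c d) refl a b c d) OQ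
      ∷ trans (solve 4 (λ a b c d → sqDist′ (:- a) (:- b) (:- c) (:- d) := sqDist′ a b c d) refl a b c d) PQ
      ∷ trans (solve 4 (λ a b c d → sqDist′ (:- c) (:- d) (a :- c) (b :- d) := norm² a b) refl a b c d) OP
      ∷ trans (solve 4 (λ a b c d → sqDist′ (a :- c) (b :- d) a b := norm² c d) refl a b c d) OQ
      ∷ []

    -- The short diagonals have squared length 3X, by the parallelogram law, and the long ones 4X.
    diagonal : 0# ≤ X → All (λ (i , j) → X ≤ sqDist (hexagon P Q i) (hexagon P Q j)) diagonals
    diagonal 0≤X =
        short OP PQ OQ (solve 4 (λ a b c d → sqDist′ a b (c :- a) (d :- b) :=
          :# 2 :* norm² a b :+ :# 2 :* sqDist′ a b c d :- norm² c d) refl a b c d)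
      ∷ short OP OQ PQ (solve 4 (λ a b c d → sqDist′ c d (:- a) (:- b) :=
          :# 2 :* norm² a b :+ :# 2 :* norm² c d :- sqDist′ a b c d) refl a b c d)
      ∷ short OQ PQ OP (solve 4 (λ a b c d → sqDist′ (c :- a) (d :- b) (:- c) (:- d) :=
          :# 2 :* norm² c d :+ :# 2 :* sqDist′ a b c d :- norm² a b) refl a b c d)
      ∷ short OP PQ OQ (solve 4 (λ a b c d → sqDist′ (:- a) (:- b) (a :- c) (b :- d) :=
          :# 2 :* norm² a b :+ :# 2 :* sqDist′ a b c d :- norm² c d) refl a b c d)
      ∷ short OP OQ PQ (solve 4 (λ a b c d → sqDist′ (:- c) (:- d) a b :=
          :# 2 :* norm² a b :+ :# 2 :* norm² c d :- sqDist′ a b c d) refl a b c d)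
      ∷ short OQ PQ OP (solve 4 (λ a b c d → sqDist′ (a :- c) (b :- d) c d :=
          :# 2 :* norm² c d :+ :# 2 :* sqDist′ a b c d :- norm² a b) refl a b c d)
      ∷ long OP (solve 4 (λ a b c d → sqDist′ a b (:- a) (:- b) := :# 4 :* norm² a b) refl a b c d)
      ∷ long OQ (solve 4 (λ a b c d → sqDist′ c d (:- c) (:- d) := :# 4 :* norm² c d) refl a b c d)
      ∷ long PQ (solve 4 (λ a b c d → sqDist′ (c :- a) (d :- b) (a :- c) (b :- d) := :# 4 :* sqDist′ a b c d) refl a b c d)
      ∷ []
      where
      short : ∀ {x y z D} → x ≈ X → y ≈ X → z ≈ X → D ≈ # 2 * x + # 2 * y - z → X ≤ D
      short {x} {y} {z} {D} x≈ y≈ z≈ D≈ = ≤-by (*-nonNegative (0≤fromℕ 2) 0≤X) (begin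
        D                          ≈⟨ D≈ ⟩
        # 2 * x + # 2 * y - z      ≈⟨ +-cong (+-cong (*-congˡ x≈) (*-congˡ y≈)) (-‿cong z≈) ⟩
        # 2 * X + # 2 * X - X      ≈⟨ solve 1 (λ X → :# 2 :* X :+ :# 2 :* X :- X := X :+ :# 2 :* X) refl X ⟩
        X + # 2 * X                ∎)
      long : ∀ {x D} → x ≈ X → D ≈ # 4 * x → X ≤ D
      long {x} {D} x≈ D≈ = ≤-by (*-nonNegative (0≤fromℕ 3) 0≤X) (begin
        D              ≈⟨ D≈ ⟩
        # 4 * x        ≈⟨ *-congˡ x≈ ⟩
        # 4 * X        ≈⟨ solve 1 (λ X → :# 4 :* X := X :+ :# 3 :* X) refl X ⟩
        X + # 3 * X    ∎)

  module TwoHexagons {E : Carrier} (P Q P′ Q′ : Point)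
    (PP′ : sqDist P P′ ≈ E) (QQ′ : sqDist Q Q′ ≈ E) (third : sqDist (Q -ᵥ P) (Q′ -ᵥ P′) ≈ E) where

    private
      a = proj₁ P
      b = proj₂ P
      c = proj₁ Q
      d = proj₂ Q
      a′ = proj₁ P′
      b′ = proj₂ P′
      c′ = proj₁ Q′
      d′ = proj₂ Q′

    corresponding : ∀ i → sqDist (hexagon P Q i) (hexagon P′ Q′ i) ≈ E
    corresponding 0F = PP′
    corresponding 1F = QQ′
    corresponding 2F = third
    corresponding 3F = trans (solve 4 (λ a b c d → sqDist′ (:- a) (:- b) (:- c) (:- d) := sqDist′ a b c d) refl a b a′ b′) PP′
    corresponding 4F = trans (solve 4 (λ a b c d → sqDist′ (:- a) (:- b) (:- c) (:- d) := sqDist′ a b c d) refl c d c′ d′) QQ′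
    corresponding 5F = trans (solve 8 (λ a b c d a′ b′ c′ d′ →
      sqDist′ (a :- c) (b :- d) (a′ :- c′) (b′ :- d′) := sqDist′ (c :- a) (d :- b) (c′ :- a′) (d′ :- b′))
      refl a b c d a′ b′ c′ d′) third

    module _ {X Y Y′ : Carrier} (balance : Y + Y′ ≈ # 2 * X + E)
      (OP : sqDist O P ≈ X) (OQ : sqDist O Q ≈ X) (PQ : sqDist P Q ≈ X)
      (OP′ : sqDist O P′ ≈ X) (OQ′ : sqDist O Q′ ≈ X) (P′Q′ : sqDist P′ Q′ ≈ X)
      (PQ′ : sqDist P Q′ ≈ Y) (QP′ : sqDist Q P′ ≈ Y′) where

      private
        -- For a parallelogram O, U, U + V, V and any point Z, the number |Z|² + |Z - U - V|² - |Z -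
        -- U|² - |Z - V|² does not depend on Z. Each use below solves such an identity for one
        -- unknown distance, which becomes 2X + E minus one of the two known crossing distances;
        -- `balance` identifies this as the other.
        combine : ∀ {Y Y′ n₁ n₂ n₃ n₄ e y D} → Y + Y′ ≈ # 2 * X + E →
                  n₁ ≈ X → n₂ ≈ X → n₃ ≈ X → n₄ ≈ X → e ≈ E → y ≈ Y′ →
                  D ≈ n₁ + n₂ + n₃ - n₄ + e - y → D ≈ Y
        combine {Y} {Y′} {n₁} {n₂} {n₃} {n₄} {e} {y} {D} bal n₁≈ n₂≈ n₃≈ n₄≈ e≈ y≈ D≈ = begin
          D                               ≈⟨ D≈ ⟩
          n₁ + n₂ + n₃ - n₄ + e - y
            ≈⟨ +-cong (+-cong (+-cong (+-cong (+-cong n₁≈ n₂≈) n₃≈) (-‿cong n₄≈)) e≈) (-‿cong y≈) ⟩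
          X + X + X - X + E - Y′
            ≈⟨ solve 3 (λ X E Y′ → X :+ X :+ X :- X :+ E :- Y′ := :# 2 :* X :+ E :- Y′) refl X E Y′ ⟩
          # 2 * X + E - Y′                ≈⟨ +-congʳ bal ⟨
          Y + Y′ - Y′                     ≈⟨ solve 2 (λ Y Y′ → Y :+ Y′ :- Y′ := Y) refl Y Y′ ⟩
          Y                               ∎

        balance′ : Y′ + Y ≈ # 2 * X + E
        balance′ = trans (+-comm Y′ Y) balance

        neg : ∀ A B → sqDist (-ᵥ A) (-ᵥ B) ≈ sqDist A B
        neg (x , y) (u , v) = solve 4 (λ x y u v → sqDist′ (:- x) (:- y) (:- u) (:- v) := sqDist′ x y u v) refl x y u v

        12₊ : sqDist Q (Q′ -ᵥ P′) ≈ Y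
        12₊ = combine balance OQ OP′ P′Q′ OQ′ QQ′ QP′ (solve 6 (λ c d a′ b′ c′ d′ →
          sqDist′ c d (c′ :- a′) (d′ :- b′) := norm² c d :+ norm² a′ b′ :+ sqDist′ a′ b′ c′ d′
            :- norm² c′ d′ :+ sqDist′ c d c′ d′ :- sqDist′ c d a′ b′) refl c d a′ b′ c′ d′)

        23₊ : sqDist (Q -ᵥ P) (-ᵥ P′) ≈ Y
        23₊ = combine balance PQ OQ OP′ OP PP′ QP′ (solve 6 (λ a b c d a′ b′ →
          sqDist′ (c :- a) (d :- b) (:- a′) (:- b′) := sqDist′ a b c d :+ norm² c d :+ norm² a′ b′
            :- norm² a b :+ sqDist′ a b a′ b′ :- sqDist′ c d a′ b′) refl a b c d a′ b′)

        21₋ : sqDist (Q -ᵥ P) Q′ ≈ Y′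
        21₋ = combine balance′ PQ OQ′ OP OQ QQ′ PQ′ (solve 6 (λ a b c d c′ d′ →
          sqDist′ (c :- a) (d :- b) c′ d′ := sqDist′ a b c d :+ norm² c′ d′ :+ norm² a b
            :- norm² c d :+ sqDist′ c d c′ d′ :- sqDist′ a b c′ d′) refl a b c d c′ d′)

        32₋ : sqDist (-ᵥ P) (Q′ -ᵥ P′) ≈ Y′
        32₋ = combine balance′ P′Q′ OP OQ′ OP′ PP′ PQ′ (solve 6 (λ a b a′ b′ c′ d′ →
          sqDist′ (:- a) (:- b) (c′ :- a′) (d′ :- b′) := sqDist′ a′ b′ c′ d′ :+ norm² a b :+ norm² c′ d′
            :- norm² a′ b′ :+ sqDist′ a b a′ b′ :- sqDist′ a b c′ d′) refl a b a′ b′ c′ d′)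

      neighbour : All (λ (i , j) → sqDist (hexagon P Q i) (hexagon P′ Q′ j) ≈ Y
                                 ⊎ sqDist (hexagon P Q i) (hexagon P′ Q′ j) ≈ Y′) adjacent
      neighbour =
          inj₁ PQ′
        ∷ inj₁ 12₊
        ∷ inj₁ 23₊
        -- Raising both indices by three is the half turn about O, so these three pairs repeat the
        -- preceding ones. The same happens in the second half of the list.
        ∷ inj₁ (trans (neg P Q′) PQ′)
        ∷ inj₁ (trans (solve 6 (λ c d a′ b′ c′ d′ →
            sqDist′ (:- c) (:- d) (a′ :- c′) (b′ :- d′) := sqDist′ c d (c′ :- a′) (d′ :- b′)) refl c d a′ b′ c′ d′) 12₊)
        ∷ inj₁ (trans (solve 6 (λ a b c d a′ b′ →
            sqDist′ (a :- c) (b :- d) a′ b′ := sqDist′ (c :- a) (d :- b) (:- a′) (:- b′)) refl a b c d a′ b′) 23₊)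
        ∷ inj₂ QP′
        ∷ inj₂ 21₋
        ∷ inj₂ 32₋
        ∷ inj₂ (trans (neg Q P′) QP′)
        ∷ inj₂ (trans (solve 6 (λ a b c d c′ d′ →
            sqDist′ (a :- c) (b :- d) (:- c′) (:- d′) := sqDist′ (c :- a) (d :- b) c′ d′) refl a b c d c′ d′) 21₋)
        ∷ inj₂ (trans (solve 6 (λ a b a′ b′ c′ d′ →
            sqDist′ a b (a′ :- c′) (b′ :- d′) := sqDist′ (:- a) (:- b) (c′ :- a′) (d′ :- b′)) refl a b a′ b′ c′ d′) 32₋)
        ∷ []

  -- (t , σ) is the unit vector at 60° to the first axis.
  t σ : Carrier
  t = # 1 / # 2
  σ = √ (# 3) * t

  2t≈1 : # 2 * t ≈ # 1
  2t≈1 = *-/-cancel (# 1) (fromℕ-suc≉0 1)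

  0≤t : 0# ≤ t
  0≤t = fromℕ-cancel-≤ 1 (≤-respˡ-≈ (sym (zeroʳ _)) (≤-respʳ-≈ (sym 2t≈1) (0≤fromℕ 1)))

  unit : t * t + σ * σ ≈ # 1
  unit = begin
    t * t + √ (# 3) * t * (√ (# 3) * t)
      ≈⟨ solve 2 (λ t r → t :* t :+ r :* t :* (r :* t) := t :* t :+ r :* r :* (t :* t)) refl t (√ (# 3)) ⟩
    t * t + √ (# 3) * √ (# 3) * (t * t)   ≈⟨ +-congˡ (*-congʳ (√-square (0≤fromℕ 3))) ⟩
    t * t + # 3 * (t * t)                 ≈⟨ solve 1 (λ t → t :* t :+ :# 3 :* (t :* t) := :# 2 :* t :* (:# 2 :* t)) refl t ⟩
    # 2 * t * (# 2 * t)                   ≈⟨ *-cong 2t≈1 2t≈1 ⟩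
    # 1 * # 1                             ≈⟨ solve 0 (:# 1 :* :# 1 := :# 1) refl ⟩
    # 1                                   ∎

  turn : Point → Point
  turn (x , y) = t * x - σ * y , σ * x + t * y

  private
    unit-* : ∀ {x y} → y ≈ (t * t + σ * σ) * x → y ≈ x
    unit-* {x} e = trans e (trans (*-congʳ unit) (solve 1 (λ x → :# 1 :* x := x) refl x))

    -- |e^{iπ/3} - 1| = 1
    unit-*′ : ∀ {x y} → y ≈ (# 1 - # 2 * t + (t * t + σ * σ)) * x → y ≈ x
    unit-*′ {x} e = trans e (trans (*-congʳ (+-cong (+-congˡ (-‿cong 2t≈1)) unit))
      (solve 1 (λ x → (:# 1 :- :# 1 :+ :# 1) :* x := x) refl x))

  turn-norm : ∀ A → sqDist O (turn A) ≈ sqDist O A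
  turn-norm (x , y) = unit-* (solve 4 (λ t s x y → norm² (t :* x :- s :* y) (s :* x :+ t :* y)
    := (t :* t :+ s :* s) :* norm² x y) refl t σ x y)

  turn-isometric : ∀ A B → sqDist (turn A) (turn B) ≈ sqDist A B
  turn-isometric (x , y) (u , v) = unit-* (solve 6 (λ t s x y u v →
    sqDist′ (t :* x :- s :* y) (s :* x :+ t :* y) (t :* u :- s :* v) (s :* u :+ t :* v)
    := (t :* t :+ s :* s) :* sqDist′ x y u v) refl t σ x y u v)

  turn-equilateral : ∀ A → sqDist A (turn A) ≈ sqDist O A
  turn-equilateral (x , y) = unit-*′ (solve 4 (λ t s x y →
    sqDist′ x y (t :* x :- s :* y) (s :* x :+ t :* y)
    := (:# 1 :- :# 2 :* t :+ (t :* t :+ s :* s)) :* norm² x y) refl t σ x y)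

  -- The map from A to `turn A -ᵥ A` is multiplication by e^{iπ/3} - 1, again a rotation. This gives
  -- the third rung of `TwoHexagons`.
  turn-third : ∀ A B → sqDist (turn A -ᵥ A) (turn B -ᵥ B) ≈ sqDist A B
  turn-third (x , y) (u , v) = unit-*′ (solve 6 (λ t s x y u v →
    sqDist′ (t :* x :- s :* y :- x) (s :* x :+ t :* y :- y) (t :* u :- s :* v :- u) (s :* u :+ t :* v :- v)
    := (:# 1 :- :# 2 :* t :+ (t :* t :+ s :* s)) :* sqDist′ x y u v) refl t σ x y u v)

  -- The base of an isosceles triangle with apex O, height `h` and half-base `e`.
  lower upper : Carrier → Carrier → Point
  lower h e = h , - e
  upper h e = h , e

  -- The squared lengths of the two crossing pairs. With r the leg and 2φ the angle at O, these are
  -- 2r² - 2r² cos(60° ± 2φ).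
  d₊ d₋ : Carrier → Carrier → Carrier
  d₊ h e = h * h + # 3 * (e * e) + # 4 * (σ * e * h)
  d₋ h e = h * h + # 3 * (e * e) - # 4 * (σ * e * h)

  private
    -- The solver treats `t` and `σ` as free variables. It is asked to expose t² + σ² and 2t, which
    -- are then replaced by 1.
    substitute : ∀ {x y z w} → w ≈ (# 1 + (t * t + σ * σ)) * x - # 2 * t * y + z →
                 w ≈ (# 1 + # 1) * x - # 1 * y + z
    substitute e = trans e (+-congʳ (+-cong (*-congʳ (+-congˡ unit)) (-‿cong (*-congʳ 2t≈1))))

  lower-turn-upper : ∀ h e → sqDist (lower h e) (turn (upper h e)) ≈ d₊ h e
  lower-turn-upper h e = trans
    (substitute (solve 4 (λ t s h e → sqDist′ h (:- e) (t :* h :- s :* e) (s :* h :+ t :* e)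
      := (:# 1 :+ (t :* t :+ s :* s)) :* (h :* h :+ e :* e) :- :# 2 :* t :* (h :* h :- e :* e)
         :+ :# 4 :* (s :* e :* h)) refl t σ h e))
    (solve 3 (λ h e y → (:# 1 :+ :# 1) :* (h :* h :+ e :* e) :- :# 1 :* (h :* h :- e :* e) :+ y
      := h :* h :+ :# 3 :* (e :* e) :+ y) refl h e (# 4 * (σ * e * h)))

  turn-lower-upper : ∀ h e → sqDist (turn (lower h e)) (upper h e) ≈ d₋ h e
  turn-lower-upper h e = trans
    (substitute (solve 4 (λ t s h e → sqDist′ (t :* h :- s :* (:- e)) (s :* h :+ t :* (:- e)) h e
      := (:# 1 :+ (t :* t :+ s :* s)) :* (h :* h :+ e :* e) :- :# 2 :* t :* (h :* h :- e :* e)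
         :+ (:- (:# 4 :* (s :* e :* h)))) refl t σ h e))
    (solve 3 (λ h e y → (:# 1 :+ :# 1) :* (h :* h :+ e :* e) :- :# 1 :* (h :* h :- e :* e) :+ (:- y)
      := h :* h :+ :# 3 :* (e :* e) :- y) refl h e (# 4 * (σ * e * h)))

  norm-lower : ∀ h e → sqDist O (lower h e) ≈ h * h + e * e
  norm-lower h e = solve 2 (λ h e → norm² h (:- e) := h :* h :+ e :* e) refl h e

  norm-upper : ∀ h e → sqDist O (upper h e) ≈ h * h + e * e
  norm-upper h e = solve 2 (λ h e → norm² h e := h :* h :+ e :* e) refl h e

  lower-upper : ∀ h e → sqDist (lower h e) (upper h e) ≈ # 4 * (e * e)
  lower-upper h e = solve 2 (λ h e → sqDist′ h (:- e) h e := :# 4 :* (e :* e)) refl h e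

  -- The `balance` hypothesis for two hexagons of squared radius h² + e² with rungs of squared
  -- length 4e².
  d₊+d₋ : ∀ h e → d₊ h e + d₋ h e ≈ # 2 * (h * h + e * e) + # 4 * (e * e)
  d₊+d₋ h e = solve 3 (λ h e y → h :* h :+ :# 3 :* (e :* e) :+ y :+ (h :* h :+ :# 3 :* (e :* e) :- y)
    := :# 2 :* (h :* h :+ e :* e) :+ :# 4 :* (e :* e)) refl h e (# 4 * (σ * e * h))

  -- The apex of a unit triangle on the side from lower h t to upper h t.
  apex : Carrier → Carrier → Point
  apex h s = h + s , 0#

  apex-lower : ∀ {s} h → s * s ≈ σ * σ → sqDist (apex h s) (lower h t) ≈ # 1
  apex-lower {s} h e = trans (solve 3 (λ h s t → sqDist′ (h :+ s) (:# 0) h (:- t) := t :* t :+ s :* s) refl h s t)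
    (trans (+-congˡ e) unit)

  apex-upper : ∀ {s} h → s * s ≈ σ * σ → sqDist (apex h s) (upper h t) ≈ # 1
  apex-upper {s} h e = trans (solve 3 (λ h s t → sqDist′ (h :+ s) (:# 0) h t := t :* t :+ s :* s) refl h s t)
    (trans (+-congˡ e) unit)

  σ²≈3t² : σ * σ ≈ # 3 * (t * t)
  σ²≈3t² = trans (solve 2 (λ r t → r :* t :* (r :* t) := r :* r :* (t :* t)) refl (√ (# 3)) t)
    (*-congʳ (√-square (0≤fromℕ 3)))

  norm-apex : ∀ {s} h → s * s ≈ σ * σ → sqDist O (apex h s) ≈ h * h + # 3 * (t * t) + # 4 * (s * t * h)
  norm-apex {s} h e = begin
    sqDist O (apex h s)
      -- The factor `# 1` is kept visible in order to be exchanged for 2t, which produces the shape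
      -- of `d₊ h t`.
      ≈⟨ solve 2 (λ h s → norm² (h :+ s) (:# 0) := h :* h :+ s :* s :+ :# 1 :* (:# 2 :* s :* h)) refl h s ⟩
    h * h + s * s + # 1 * (# 2 * s * h)
      ≈⟨ +-cong (+-congˡ (trans e σ²≈3t²)) (*-congʳ (sym 2t≈1)) ⟩
    h * h + # 3 * (t * t) + # 2 * t * (# 2 * s * h)
      ≈⟨ +-congˡ (solve 3 (λ h s t → :# 2 :* t :* (:# 2 :* s :* h) := :# 4 :* (s :* t :* h)) refl h s t) ⟩
    h * h + # 3 * (t * t) + # 4 * (s * t * h)   ∎

  -- Geometrically, two turns by -60°, the first about O and the second about `lower h t`, take
  -- `turn (upper h t)` to the apex and `lower h t` to O.
  d₊≈norm-apex : ∀ h → d₊ h t ≈ sqDist O (apex h σ)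
  d₊≈norm-apex h = sym (norm-apex h refl)

  d₋≈norm-apex : ∀ h → d₋ h t ≈ sqDist O (apex h (- σ))
  d₋≈norm-apex h = sym (trans
    (norm-apex h (solve 1 (λ s → :- s :* :- s := s :* s) refl σ))
    (+-congˡ (solve 3 (λ h s t → :# 4 :* (:- s :* t :* h) := :- (:# 4 :* (s :* t :* h))) refl h σ t)))

-- Upper bounds for the probability at distances of at least 1/2.

module Bounds (ℝ : CompleteOrderedField) where
  open CompleteOrderedField ℝ
  open RealArithmetic ℝ
  open PlaneGeometry ℝ
  open Hexagons ℝ
  open RandomColouring ℝ
  open SquareRoot ℝ using (√_; √-square)
  open Plane ℝ
  open Tally

  module _ (c₀ : ProperColouring) (P : InvariantProbability ℝ S₄×E₂) where
    open SetoidReasoning setoid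

    open Probability c₀ P

    distinct : ∀ {A B} → sqDist A B ≈ # 1 → ∀ g → c g A ≢ c g B
    distinct {A} {B} e = c-proper {A} {B} (trans e (+-identityʳ 1#))

    -- `B` and `C` differ in colour, so `A` agrees with at most one of them, and the two events are
    -- equally likely.
    p-isosceles : ∀ {A B C} → sqDist A B ≈ sqDist A C → sqDist B C ≈ # 1 → # 2 * p A B ≤ # 1
    p-isosceles {A} {B} {C} AB≈AC BC =
      ≤-respˡ-≈ (begin
        # 0 + (# 1 * p A B + (# 1 * p A C + 0#))
          ≈⟨ +-congˡ (+-congˡ (+-congʳ (*-congˡ (p-sqDist AB≈AC)))) ⟨
        # 0 + (# 1 * p A B + (# 1 * p A B + 0#))
          ≈⟨ solve 1 (λ x → :# 0 :+ (:# 1 :* x :+ (:# 1 :* x :+ :# 0)) := :# 2 :* x) refl (p A B) ⟩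
        # 2 * p A B    ∎)
      (≤-respʳ-≈ (+-identityʳ (# 1))
        (expectation-≤ 0 1 ((1 , A , B) ∷ (1 , A , C) ∷ []) [] λ g →
          let x = c g in
          ≡.subst (ℕ._≤ 1) (≡.sym (≡.cong₂ ℕ._+_ (ℕ.*-identityˡ (same (x A) (x B)))
              (≡.trans (ℕ.+-identityʳ _) (ℕ.*-identityˡ (same (x A) (x C))))))
            (same-+ (x A) (distinct {B} {C} BC g))))

    -- The vertices of the unit triangle BCD have three different colours, and `A` agrees with at
    -- most one of them.
    p-unitTriangle : ∀ {A B C D} → sqDist A B ≈ sqDist A C →
      sqDist B C ≈ # 1 → sqDist D B ≈ # 1 → sqDist D C ≈ # 1 → p A D ≤ # 1 - # 2 * p A B
    p-unitTriangle {A} {B} {C} {D} AB≈AC BC DB DC = 0≤-⇒≤ (≤-respʳ-≈ (begin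
        # 1 + 0# - (# 0 + (# 1 * p A D + (# 1 * p A B + (# 1 * p A C + 0#))))
          ≈⟨ +-congˡ (-‿cong (+-congˡ (+-congˡ (+-congˡ (+-congʳ (*-congˡ (p-sqDist AB≈AC))))))) ⟨
        # 1 + 0# - (# 0 + (# 1 * p A D + (# 1 * p A B + (# 1 * p A B + 0#))))
          ≈⟨ solve 2 (λ y x → :# 1 :+ :# 0 :- (:# 0 :+ (:# 1 :* y :+ (:# 1 :* x :+ (:# 1 :* x :+ :# 0))))
               := :# 1 :- :# 2 :* x :- y) refl (p A D) (p A B) ⟩
        # 1 - # 2 * p A B - p A D    ∎)
      (≤⇒0≤- (expectation-≤ 0 1 ((1 , A , D) ∷ (1 , A , B) ∷ (1 , A , C) ∷ []) [] λ g →
          let x = c g in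
          ≡.subst (ℕ._≤ 1) (≡.sym (≡.cong₂ ℕ._+_ (ℕ.*-identityˡ (same (x A) (x D)))
              (≡.cong₂ ℕ._+_ (ℕ.*-identityˡ (same (x A) (x B)))
              (≡.trans (ℕ.+-identityʳ _) (ℕ.*-identityˡ (same (x A) (x C)))))))
            (same-+-+ (x A) (distinct {D} {B} DB g) (distinct {D} {C} DC g) (distinct {B} {C} BC g)))))

    4t²≈1 : # 4 * (t * t) ≈ # 1
    4t²≈1 = begin
      # 4 * (t * t)         ≈⟨ solve 1 (λ t → :# 4 :* (t :* t) := :# 2 :* t :* (:# 2 :* t)) refl t ⟩
      # 2 * t * (# 2 * t)   ≈⟨ *-cong 2t≈1 2t≈1 ⟩
      # 1 * # 1             ≈⟨ solve 0 (:# 1 :* :# 1 := :# 1) refl ⟩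
      # 1                   ∎

    height : Carrier → Carrier
    height X = √ (X - t * t)

    -- The hypothesis says that the legs are at least 1/2, so that an isosceles triangle on a unit
    -- base exists.
    height² : ∀ {X} → # 1 ≤ # 4 * X → height X * height X + t * t ≈ X
    height² {X} h = trans (+-congʳ (√-square (≤⇒0≤- (fromℕ-cancel-≤ 3 (≤-respˡ-≈ (sym 4t²≈1) h)))))
      (solve 2 (λ X y → X :- y :+ y := X) refl X (t * t))

    p-half : ∀ A B → # 1 ≤ # 4 * sqDist A B → # 2 * p A B ≤ # 1
    p-half A B spread = ≤-respˡ-≈ (*-congˡ (p-sqDist (trans OL (height² spread))))
      (p-isosceles {O} {lower h t} {upper h t} (trans OL (sym (norm-upper h t)))
        (trans (lower-upper h t) 4t²≈1))
      where
      h = height (sqDist A B)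
      OL = norm-lower h t

    p-≤t : ∀ A B → # 1 ≤ # 4 * sqDist A B → p A B ≤ t
    p-≤t A B spread = fromℕ-cancel-≤ 1 (≤-respʳ-≈ (sym 2t≈1) (p-half A B spread))

    -- `L` and `U` span a unit base with apex O and legs of squared length `X`. The hexagons are
    -- their orbits under `turn`, and `q` is the common probability of all spokes and hexagon sides.
    module _ {X : Carrier} (spread : # 1 ≤ # 4 * X) where
      private
        h = height X
        L = lower h t
        U = upper h t
        q = p O L
        hh : h * h + t * t ≈ X
        hh = height² spread
        OL : sqDist O L ≈ X
        OL = trans (norm-lower h t) hh
        OU : sqDist O U ≈ X
        OU = trans (norm-upper h t) hh
        LU : sqDist L U ≈ # 1
        LU = trans (lower-upper h t) 4t²≈1
        OTL : sqDist O (turn L) ≈ X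
        OTL = trans (turn-norm L) OL
        OTU : sqDist O (turn U) ≈ X
        OTU = trans (turn-norm U) OU
        LTL : sqDist L (turn L) ≈ X
        LTL = trans (turn-equilateral L) OL
        UTU : sqDist U (turn U) ≈ X
        UTU = trans (turn-equilateral U) OU
        TLTU : sqDist (turn L) (turn U) ≈ # 1
        TLTU = trans (turn-isometric L U) LU
        third : sqDist (turn L -ᵥ L) (turn U -ᵥ U) ≈ # 1
        third = trans (turn-third L U) LU

        0≤X : 0# ≤ X
        0≤X = ≤-respʳ-≈ OL (0≤sqDist O L)

        module I = Equilateral L (turn L) OL OTL LTL
        module J = Equilateral U (turn U) OU OTU UTU
        module T = TwoHexagons L (turn L) U (turn U) LU TLTU third

        pts : Vertex → Point
        pts = place L (turn L) U (turn U)

        at-X : ∀ A B → sqDist A B ≈ X → p A B ≈ q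
        at-X A B e = p-sqDist (trans e (sym OL))

        beyond-X : ∀ A B → X ≤ sqDist A B → p A B ≤ t
        beyond-X A B X≤ = p-≤t A B (≤-trans spread (*-monoʳ-≤ (0≤fromℕ 4) X≤))

        apex-bound : ∀ s → s * s ≈ σ * σ → p O (apex h s) ≤ # 1 - # 2 * q
        apex-bound s e = p-unitTriangle {O} {L} {U} {apex h s} (trans OL (sym OU)) LU (apex-lower h e) (apex-upper h e)

        neighbour-bound : ∀ A B → sqDist A B ≈ d₊ h t ⊎ sqDist A B ≈ d₋ h t → p A B ≤ # 1 - # 2 * q
        neighbour-bound A B (inj₁ e) = ≤-respˡ-≈ (sym (p-sqDist (trans e (d₊≈norm-apex h)))) (apex-bound σ refl)
        neighbour-bound A B (inj₂ e) = ≤-respˡ-≈ (sym (p-sqDist (trans e (d₋≈norm-apex h))))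
          (apex-bound (- σ) (solve 1 (λ s → :- s :* :- s := s :* s) refl σ))

        SI DI SJ DJ N : WeightedPairs Point
        SI = relabel pts (pairs 1 inner inner sides)
        DI = relabel pts (pairs 1 inner inner diagonals)
        SJ = relabel pts (pairs 1 outer outer sides)
        DJ = relabel pts (pairs 1 outer outer diagonals)
        N  = relabel pts neighbours

        spokes-≥ : # 84 * q ≤ expected (relabel pts spokes)
        spokes-≥ = expected-≥ {q} {relabel pts spokes}
          (i 0F ∷ i 1F ∷ i 2F ∷ i 3F ∷ i 4F ∷ i 5F ∷ j 0F ∷ j 1F ∷ j 2F ∷ j 3F ∷ j 4F ∷ j 5F ∷ [])
          where
          i : ∀ k → q ≤ p O (hexagon L (turn L) k)
          i k = ≤-reflexive (sym (at-X O (hexagon L (turn L) k) (I.centre-vertex k)))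
          j : ∀ k → q ≤ p O (hexagon U (turn U) k)
          j k = ≤-reflexive (sym (at-X O (hexagon U (turn U) k) (J.centre-vertex k)))

        SI-≤ : expected SI ≤ # 6 * q
        SI-≤ = expected-≤ {q} {SI} (All-pairs (λ A B → p A B ≤ q) pts 1 inner inner sides (All.map
          (λ {ij} e → ≤-reflexive (at-X (pts (inner (proj₁ ij))) (pts (inner (proj₂ ij))) e)) I.side))
        SJ-≤ : expected SJ ≤ # 6 * q
        SJ-≤ = expected-≤ {q} {SJ} (All-pairs (λ A B → p A B ≤ q) pts 1 outer outer sides (All.map
          (λ {ij} e → ≤-reflexive (at-X (pts (outer (proj₁ ij))) (pts (outer (proj₂ ij))) e)) J.side))
        DI-≤ : expected DI ≤ # 9 * t
        DI-≤ = expected-≤ {t} {DI} (All-pairs (λ A B → p A B ≤ t) pts 1 inner inner diagonals (All.map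
          (λ {ij} → beyond-X (pts (inner (proj₁ ij))) (pts (inner (proj₂ ij)))) (I.diagonal 0≤X)))
        DJ-≤ : expected DJ ≤ # 9 * t
        DJ-≤ = expected-≤ {t} {DJ} (All-pairs (λ A B → p A B ≤ t) pts 1 outer outer diagonals (All.map
          (λ {ij} → beyond-X (pts (outer (proj₁ ij))) (pts (outer (proj₂ ij)))) (J.diagonal 0≤X)))

        balance : d₊ h t + d₋ h t ≈ # 2 * X + # 1
        balance = trans (d₊+d₋ h t) (+-cong (*-congˡ hh) 4t²≈1)

        N-≤ : expected N ≤ # 72 * (# 1 - # 2 * q)
        N-≤ = expected-≤ {# 1 - # 2 * q} {N} (All-pairs (λ A B → p A B ≤ # 1 - # 2 * q) pts 6 inner outer adjacent (All.map
          (λ {ij} → neighbour-bound (pts (inner (proj₁ ij))) (pts (outer (proj₂ ij))))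
          (T.neighbour balance OL OTL LTL OU OTU UTU (lower-turn-upper h t) (turn-lower-upper h t))))

        proper-rungs : ∀ g k → c g (pts (inner k)) ≢ c g (pts (outer k))
        proper-rungs g k = distinct {pts (inner k)} {pts (outer k)} (T.corresponding k) g

        -- The list on the right is what `relabel pts (hexagons ++ neighbours)` evaluates to,
        -- grouped so that each block has its own bound.
        spokes-expected : # 0 + expected (relabel pts spokes)
                        ≤ # 24 + expected (((SI ++ DI) ++ (SJ ++ DJ)) ++ N)
        spokes-expected = expectation-≤ 0 24 (relabel pts spokes) (relabel pts (hexagons ++ neighbours)) λ g →
          ≡.subst₂ ℕ._≤_ (≡.sym (tally-relabel pts spokes (c g)))
            (≡.cong (24 ℕ.+_) (≡.sym (tally-relabel pts (hexagons ++ neighbours) (c g))))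
            (spokes-≤ (c g ∘ pts) (proper-rungs g))

        split : expected (((SI ++ DI) ++ (SJ ++ DJ)) ++ N) ≈
                expected SI + expected DI + (expected SJ + expected DJ) + expected N
        split = trans (expected-++ ((SI ++ DI) ++ (SJ ++ DJ)) N) (+-congʳ
          (trans (expected-++ (SI ++ DI) (SJ ++ DJ)) (+-cong (expected-++ SI DI) (expected-++ SJ DJ))))

        combined : # 84 * q ≤ # 24 + (# 6 * q + # 9 * t + (# 6 * q + # 9 * t) + # 72 * (# 1 - # 2 * q))
        combined = ≤-trans spokes-≥ (≤-trans (≤-respˡ-≈ (+-identityˡ _) spokes-expected)
          (+-mono-≤ ≤-refl (≤-respˡ-≈ (sym split)
            (+-mono-≤ (+-mono-≤ (+-mono-≤ SI-≤ DI-≤) (+-mono-≤ SJ-≤ DJ-≤)) N-≤))))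

        -- The twelve spokes of weight 7 give 84q; on the right stand 24, twelve sides, eighteen
        -- diagonals bounded by t = 1/2, and twelve neighbours of weight 6. Thus 84q ≤ 24 + 12q + 9
        -- + 72(1 - 2q), or 216q ≤ 105.
        q-bound : # 72 * q ≤ # 35
        q-bound = fromℕ-cancel-≤ 2 (0≤-⇒≤ (≤-respʳ-≈ (begin
          # 24 + (# 6 * q + # 9 * t + (# 6 * q + # 9 * t) + # 72 * (# 1 - # 2 * q)) - # 84 * q
            ≈⟨ solve 2 (λ q t → :# 24 :+ (:# 6 :* q :+ :# 9 :* t :+ (:# 6 :* q :+ :# 9 :* t)
                 :+ :# 72 :* (:# 1 :- :# 2 :* q)) :- :# 84 :* q
                 := :# 96 :+ :# 9 :* (:# 2 :* t) :- :# 3 :* (:# 72 :* q)) refl q t ⟩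
          # 96 + # 9 * (# 2 * t) - # 3 * (# 72 * q)
            ≈⟨ +-congʳ (+-congˡ (*-congˡ 2t≈1)) ⟩
          # 96 + # 9 * # 1 - # 3 * (# 72 * q)
            ≈⟨ solve 1 (λ x → :# 96 :+ :# 9 :* :# 1 :- x := :# 3 :* :# 35 :- x) refl (# 3 * (# 72 * q)) ⟩
          # 3 * # 35 - # 3 * (# 72 * q)   ∎) (≤⇒0≤- combined)))

      p-≤-35/72-at : ∀ A B → sqDist A B ≈ X → # 72 * p A B ≤ # 35
      p-≤-35/72-at A B e = ≤-respˡ-≈ (*-congˡ (sym (at-X A B e))) q-bound

    p-≤-35/72 : ∀ A B → # 1 ≤ # 4 * sqDist A B → # 72 * p A B ≤ # 35
    p-≤-35/72 A B spread = p-≤-35/72-at spread A B refl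

-- The lower bound 1/72 from two unit chords of a unit circle.

module Distances (ℝ : CompleteOrderedField) where
  open CompleteOrderedField ℝ
  open RealArithmetic ℝ
  open PlaneGeometry ℝ
  open Hexagons ℝ
  open RandomColouring ℝ
  open Bounds ℝ
  open SquareRoot ℝ using (√_; √-nonNegative; √-square)
  open Plane ℝ
  open Tally using (rectangle)
  open SetoidReasoning setoid

  #-≤ : ∀ m n {m≤n : True (m ℕ.≤? n)} → # m ≤ # n
  #-≤ m n {m≤n} = fromℕ-mono-≤ (toWitness m≤n)

  module _ {e h : Carrier} (0≤e : 0# ≤ e) (0≤h : 0# ≤ h) (hh+ee : h * h + e * e ≈ # 1) where

    private
      f = e * e
      y = σ * e * h

      0≤σ : 0# ≤ σ
      0≤σ = *-nonNegative (√-nonNegative (# 3)) 0≤t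

      0≤y : 0# ≤ y
      0≤y = *-nonNegative (*-nonNegative 0≤σ 0≤e) 0≤h

      16²y² : # 16 * y * (# 16 * y) ≈ # 192 * (f * (# 1 - f))
      16²y² = begin
        # 16 * y * (# 16 * y)
          ≈⟨ solve 3 (λ s e h → :# 16 :* (s :* e :* h) :* (:# 16 :* (s :* e :* h))
               := :# 256 :* (s :* s) :* (e :* e :* (h :* h))) refl σ e h ⟩
        # 256 * (σ * σ) * (f * (h * h))     ≈⟨ *-cong (*-congˡ σ²≈3t²) (*-congˡ hh) ⟩
        # 256 * (# 3 * (t * t)) * (f * (# 1 - f))
          ≈⟨ solve 2 (λ t x → :# 256 :* (:# 3 :* (t :* t)) :* x
               := :# 192 :* (:# 2 :* t :* (:# 2 :* t)) :* x) refl t (f * (# 1 - f)) ⟩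
        # 192 * (# 2 * t * (# 2 * t)) * (f * (# 1 - f))
          ≈⟨ *-congʳ (*-congˡ (*-cong 2t≈1 2t≈1)) ⟩
        # 192 * (# 1 * # 1) * (f * (# 1 - f))
          ≈⟨ solve 1 (λ x → :# 192 :* (:# 1 :* :# 1) :* x := :# 192 :* x) refl (f * (# 1 - f)) ⟩
        # 192 * (f * (# 1 - f))             ∎
        where
        hh : h * h ≈ # 1 - f
        hh = trans (solve 2 (λ x f → x := x :+ f :- f) refl (h * h) f) (+-congʳ hh+ee)

    -- On the unit circle 4 `d₊` = 4 + 8e² + 16σeh, with every term nonnegative.
    d₊-spread : # 1 ≤ # 4 * d₊ h e
    d₊-spread = ≤-by (0≤+ (0≤+ (0≤fromℕ 3) (*-nonNegative (0≤fromℕ 8) (0≤sq e))) (*-nonNegative (0≤fromℕ 16) 0≤y))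
      (trans (solve 3 (λ h e y → :# 4 :* (h :* h :+ :# 3 :* (e :* e) :+ :# 4 :* y)
               := :# 4 :* (h :* h :+ e :* e) :+ (:# 8 :* (e :* e) :+ :# 16 :* y)) refl h e y)
        (trans (+-congʳ (*-congˡ hh+ee))
          (solve 2 (λ f y → :# 4 :* :# 1 :+ (:# 8 :* f :+ :# 16 :* y)
            := :# 1 :+ (:# 3 :+ :# 8 :* f :+ :# 16 :* y)) refl f y)))

    -- (3 + 8f)² - (16y)² = 16 (4f)² - 36 (4f) + 9
    d₋-spread : # 36 * (# 4 * f) ≤ # 16 * (# 4 * f * (# 4 * f)) + # 9 → # 1 ≤ # 4 * d₋ h e
    d₋-spread gap = ≤-by (≤⇒0≤- 16y≤)
      (trans (solve 3 (λ h e y → :# 4 :* (h :* h :+ :# 3 :* (e :* e) :- :# 4 :* y)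
               := :# 4 :* (h :* h :+ e :* e) :+ (:# 8 :* (e :* e) :- :# 16 :* y)) refl h e y)
        (trans (+-congʳ (*-congˡ hh+ee))
          (solve 2 (λ f y → :# 4 :* :# 1 :+ (:# 8 :* f :- :# 16 :* y)
            := :# 1 :+ (:# 3 :+ :# 8 :* f :- :# 16 :* y)) refl f y)))
      where
      16y≤ : # 16 * y ≤ # 3 + # 8 * f
      16y≤ = sq-cancel-≤ (0≤+ (0≤fromℕ 3) (*-nonNegative (0≤fromℕ 8) (0≤sq e)))
        (≤-respˡ-≈ (sym 16²y²) (≤-by (≤⇒0≤- gap) (solve 1 (λ f →
          (:# 3 :+ :# 8 :* f) :* (:# 3 :+ :# 8 :* f) := :# 192 :* (f :* (:# 1 :- f)) :+
          (:# 16 :* (:# 4 :* f :* (:# 4 :* f)) :+ :# 9 :- :# 36 :* (:# 4 :* f))) refl f)))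

  -- For D = d², the first condition lets a chord of length d fit in the unit circle, and the second
  -- keeps the shorter crossing distance at least 1/2.
  Admissible : Carrier → Set
  Admissible D = D ≤ # 4 × # 36 * D ≤ # 16 * (D * D) + # 9

  module _ (c₀ : ProperColouring) (P : InvariantProbability ℝ S₄×E₂) where
    open Probability c₀ P

    p-≥-1/72 : ∀ {d A B} → 0# ≤ d → dist A B ≈ d → Admissible (d * d) → # 1 ≤ # 72 * p A B
    p-≥-1/72 {d} {A} {B} 0≤d AB (D≤4 , gap) = fromℕ-cancel-≤ 1 (0≤-⇒≤ (≤-respʳ-≈ (begin
        # 35 + # 35 + # 144 * q - # 72
          ≈⟨ solve 1 (λ q → :# 35 :+ :# 35 :+ :# 144 :* q :- :# 72 := :# 2 :* (:# 72 :* q) :- :# 2 :* :# 1) refl q ⟩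
        # 2 * (# 72 * q) - # 2 * # 1   ∎) (≤⇒0≤- bound)))
      where
      q = p A B
      -- Half the chord: `L` and `U` lie on the unit circle at distance d. The unit chords are `L`,
      -- `TL` and `U`, `TU`.
      e = d * t
      h = √ (# 1 - e * e)
      4ee : # 4 * (e * e) ≈ d * d
      4ee = begin
        # 4 * (d * t * (d * t))   ≈⟨ solve 2 (λ d t → :# 4 :* (d :* t :* (d :* t)) := d :* d :* (:# 2 :* t :* (:# 2 :* t))) refl d t ⟩
        d * d * (# 2 * t * (# 2 * t))   ≈⟨ *-congˡ (*-cong 2t≈1 2t≈1) ⟩
        d * d * (# 1 * # 1)       ≈⟨ solve 1 (λ x → x :* (:# 1 :* :# 1) := x) refl (d * d) ⟩
        d * d                     ∎
      ee≤1 : e * e ≤ # 1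
      ee≤1 = fromℕ-cancel-≤ 3 (≤-respˡ-≈ (sym 4ee) (≤-respʳ-≈ (solve 0 (:# 4 := :# 4 :* :# 1) refl) D≤4))
      0≤e : 0# ≤ e
      0≤e = *-nonNegative 0≤d 0≤t
      hh : h * h + e * e ≈ # 1
      hh = trans (+-congʳ (√-square (≤⇒0≤- ee≤1))) (solve 2 (λ x y → x :- y :+ y := x) refl (# 1) (e * e))
      L U TL TU : Point
      L = lower h e
      U = upper h e
      TL = turn L
      TU = turn U
      OL : sqDist O L ≈ # 1
      OL = trans (norm-lower h e) hh
      OU : sqDist O U ≈ # 1
      OU = trans (norm-upper h e) hh
      OTL : sqDist O TL ≈ # 1
      OTL = trans (turn-norm L) OL
      OTU : sqDist O TU ≈ # 1
      OTU = trans (turn-norm U) OU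
      LTL : sqDist L TL ≈ # 1
      LTL = trans (turn-equilateral L) OL
      UTU : sqDist U TU ≈ # 1
      UTU = trans (turn-equilateral U) OU
      AB² : sqDist A B ≈ d * d
      AB² = trans (sym (dist²≈sqDist A B)) (*-cong AB AB)
      LU : sqDist L U ≈ sqDist A B
      LU = trans (lower-upper h e) (trans 4ee (sym AB²))
      TLTU : sqDist TL TU ≈ sqDist A B
      TLTU = trans (turn-isometric L U) LU
      0≤h : 0# ≤ h
      0≤h = √-nonNegative _
      gap′ : # 36 * (# 4 * (e * e)) ≤ # 16 * (# 4 * (e * e) * (# 4 * (e * e))) + # 9
      gap′ = ≤-respˡ-≈ (*-congˡ (sym 4ee)) (≤-respʳ-≈ (+-congʳ (*-congˡ (sym (*-cong 4ee 4ee)))) gap)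
      far : # 72 * p L TU ≤ # 35
      far = p-≤-35/72 c₀ P L TU (≤-respʳ-≈ (*-congˡ (sym (lower-turn-upper h e))) (d₊-spread 0≤e 0≤h hh))
      near : # 72 * p TL U ≤ # 35
      near = p-≤-35/72 c₀ P TL U (≤-respʳ-≈ (*-congˡ (sym (turn-lower-upper h e))) (d₋-spread 0≤e 0≤h hh gap′))
      some : # 1 + 0# ≤ # 0 + (# 1 * p L U + (# 1 * p TL TU + (# 1 * p L TU + (# 1 * p TL U + 0#))))
      some = expectation-≤ 1 0 [] ((1 , L , U) ∷ (1 , TL , TU) ∷ (1 , L , TU) ∷ (1 , TL , U) ∷ []) λ g →
        rectangle (c g O) (c g L) (c g TL) (c g U) (c g TU)
          (distinct c₀ P {O} {L} OL g) (distinct c₀ P {O} {TL} OTL g) (distinct c₀ P {O} {U} OU g)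
          (distinct c₀ P {O} {TU} OTU g) (distinct c₀ P {L} {TL} LTL g) (distinct c₀ P {U} {TU} UTU g)
      -- Both `L U` and `TL TU` have length d, so `some` reads 1 ≤ 2q + `p L TU` + `p TL U`, and
      -- each crossing term is at most 35/72.
      bound : # 72 ≤ # 35 + # 35 + # 144 * q
      bound = ≤-respˡ-≈ (solve 0 (:# 72 :* (:# 1 :+ :# 0) := :# 72) refl)
        (≤-trans (*-monoʳ-≤ (0≤fromℕ 72) some) (≤-respˡ-≈ (begin
          # 72 * p L TU + # 72 * p TL U + # 144 * q
            ≈⟨ solve 3 (λ x y q → :# 72 :* x :+ :# 72 :* y :+ :# 144 :* q
                 := :# 72 :* (:# 0 :+ (:# 1 :* q :+ (:# 1 :* q :+ (:# 1 :* x :+ (:# 1 :* y :+ :# 0))))))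
                 refl (p L TU) (p TL U) q ⟩
          # 72 * (# 0 + (# 1 * q + (# 1 * q + (# 1 * p L TU + (# 1 * p TL U + 0#)))))
            ≈⟨ *-congˡ (+-congˡ (+-cong (*-congˡ (sym (p-sqDist LU))) (+-congʳ (*-congˡ (sym (p-sqDist TLTU)))))) ⟩
          # 72 * (# 0 + (# 1 * p L U + (# 1 * p TL TU + (# 1 * p L TU + (# 1 * p TL U + 0#)))))  ∎)
          (+-mono-≤ (+-mono-≤ far near) ≤-refl)))

-- Checking that the six ranges consist of admissible distances.

module Thresholds (ℝ : CompleteOrderedField) where
  open CompleteOrderedField ℝ
  open RealArithmetic ℝ
  open Distances ℝ
  open SquareRoot ℝ using (√_; √-nonNegative; √-square)
  open SemiringMult semiring using (×1-homo-*)
  open SetoidReasoning setoid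

  √# : ∀ n → √ # n * √ # n ≈ # n
  √# n = √-square (0≤fromℕ n)

  -- A rational bound a/b ≤ y for y² = m/(n + 1). After squaring it is a comparison of natural
  -- numbers, decided by evaluation.
  ≤-* : ∀ a b {y} m n {h : True (a ℕ.* a ℕ.* suc n ℕ.≤? b ℕ.* b ℕ.* m)} →
        0# ≤ y → # (suc n) * (y * y) ≈ # m → # a ≤ # b * y
  ≤-* a b {y} m n {h} 0≤y e = sq-cancel-≤ (*-nonNegative (0≤fromℕ b) 0≤y) (fromℕ-cancel-≤ n
    (≤-respˡ-≈ (begin
        # (a ℕ.* a ℕ.* suc n)        ≈⟨ trans (×1-homo-* (a ℕ.* a) (suc n)) (*-congʳ (×1-homo-* a a)) ⟩
        # a * # a * # (suc n)        ≈⟨ *-comm _ _ ⟩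
        # (suc n) * (# a * # a)      ∎)
      (≤-respʳ-≈ (begin
        # (b ℕ.* b ℕ.* m)                  ≈⟨ trans (×1-homo-* (b ℕ.* b) m) (*-congʳ (×1-homo-* b b)) ⟩
        # b * # b * # m                    ≈⟨ *-congˡ e ⟨
        # b * # b * (# (suc n) * (y * y))
          ≈⟨ solve 3 (λ b n y → b :* b :* (n :* (y :* y)) := n :* (b :* y :* (b :* y))) refl (# b) (# (suc n)) y ⟩
        # (suc n) * (# b * y * (# b * y))  ∎)
      (fromℕ-mono-≤ (toWitness h)))))

  *-≤ : ∀ a b {y} m n {h : True (b ℕ.* b ℕ.* m ℕ.≤? a ℕ.* a ℕ.* suc n)} →
        # (suc n) * (y * y) ≈ # m → # b * y ≤ # a
  *-≤ a b {y} m n {h} e = sq-cancel-≤ (0≤fromℕ a) (fromℕ-cancel-≤ n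
    (≤-respʳ-≈ (begin
        # (a ℕ.* a ℕ.* suc n)        ≈⟨ trans (×1-homo-* (a ℕ.* a) (suc n)) (*-congʳ (×1-homo-* a a)) ⟩
        # a * # a * # (suc n)        ≈⟨ *-comm _ _ ⟩
        # (suc n) * (# a * # a)      ∎)
      (≤-respˡ-≈ (begin
        # (b ℕ.* b ℕ.* m)                  ≈⟨ trans (×1-homo-* (b ℕ.* b) m) (*-congʳ (×1-homo-* b b)) ⟩
        # b * # b * # m                    ≈⟨ *-congˡ e ⟨
        # b * # b * (# (suc n) * (y * y))
          ≈⟨ solve 3 (λ b n y → b :* b :* (n :* (y :* y)) := n :* (b :* y :* (b :* y))) refl (# b) (# (suc n)) y ⟩
        # (suc n) * (# b * y * (# b * y))  ∎)
      (fromℕ-mono-≤ (toWitness h)))))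

  -- `# 1` unfolds to `1# + 0#`, so `*-identityˡ` does not apply to it directly.
  #1* : ∀ x → # 1 * x ≈ x
  #1* x = trans (*-congʳ (+-identityʳ 1#)) (*-identityˡ x)

  -- 64 (16D² - 36D + 9) = x (x + 54) + 9 for x = 9 - 32D and for x = 32D - 63.
  admissible-small : ∀ {D} → # 32 * D ≤ # 9 → Admissible D
  admissible-small {D} p =
    fromℕ-cancel-≤ 31 (≤-trans p (≤-respʳ-≈ (solve 0 (:# 128 := :# 32 :* :# 4) refl) (#-≤ 9 128))) ,
    fromℕ-cancel-≤ 63 (≤-by (0≤+ (*-nonNegative 0≤x (0≤+ 0≤x (0≤fromℕ 54))) (0≤fromℕ 9))
      (solve 1 (λ D → let x = :# 9 :- :# 32 :* D in
        :# 64 :* (:# 16 :* (D :* D) :+ :# 9) := :# 64 :* (:# 36 :* D) :+ (x :* (x :+ :# 54) :+ :# 9)) refl D))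
    where 0≤x = ≤⇒0≤- p

  admissible-large : ∀ {D} → # 63 ≤ # 32 * D → D ≤ # 4 → Admissible D
  admissible-large {D} p D≤4 = D≤4 ,
    fromℕ-cancel-≤ 63 (≤-by (0≤+ (*-nonNegative 0≤x (0≤+ 0≤x (0≤fromℕ 54))) (0≤fromℕ 9))
      (solve 1 (λ D → let x = :# 32 :* D :- :# 63 in
        :# 64 :* (:# 16 :* (D :* D) :+ :# 9) := :# 64 :* (:# 36 :* D) :+ (x :* (x :+ :# 54) :+ :# 9)) refl D))
    where 0≤x = ≤⇒0≤- p

  ≤-/⇒*-≤ : ∀ {x y} n → x ≤ y / # (suc n) → # (suc n) * x ≤ y
  ≤-/⇒*-≤ n p = ≤-respʳ-≈ (*-/-cancel _ (fromℕ-suc≉0 n)) (*-monoʳ-≤ (0≤fromℕ (suc n)) p)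

  k : Carrier
  k = (√ # 5) ⁻¹

  √5≉0 : ¬ √ # 5 ≈ 0#
  √5≉0 e = fromℕ-suc≉0 4 (trans (sym (√# 5)) (trans (*-congʳ e) (zeroˡ _)))

  5k²≈1 : # 5 * (k * k) ≈ # 1
  5k²≈1 = begin
    # 5 * (k * k)               ≈⟨ *-congʳ (√# 5) ⟨
    √ # 5 * √ # 5 * (k * k)     ≈⟨ solve 2 (λ r k → r :* r :* (k :* k) := r :* k :* (r :* k)) refl (√ # 5) k ⟩
    √ # 5 * k * (√ # 5 * k)     ≈⟨ *-cong (⁻¹-inverse √5≉0) (⁻¹-inverse √5≉0) ⟩
    1# * 1#                     ≈⟨ *-identityˡ 1# ⟩
    1#                          ≈⟨ +-identityʳ 1# ⟨
    # 1                         ∎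

  0≤k : 0# ≤ k
  0≤k = ≤-respʳ-≈ (begin
      √ # 5 * (k * k)   ≈⟨ solve 2 (λ r k → r :* (k :* k) := r :* k :* k) refl (√ # 5) k ⟩
      √ # 5 * k * k     ≈⟨ *-congʳ (⁻¹-inverse √5≉0) ⟩
      1# * k            ≈⟨ *-identityˡ k ⟩
      k                 ∎) (*-nonNegative (√-nonNegative (# 5)) (0≤sq k))

  sq-≤-difference : ∀ {d u v x y} → 0# ≤ d → d ≤ u - v → u * u ≈ x → v * v ≈ y → d * d ≤ x + y - # 2 * (u * v)
  sq-≤-difference {d} {u} {v} {x} {y} 0≤d p uu vv = ≤-respʳ-≈ (begin
    (u - v) * (u - v)            ≈⟨ solve 2 (λ u v → (u :- v) :* (u :- v) := u :* u :+ v :* v :- :# 2 :* (u :* v)) refl u v ⟩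
    u * u + v * v - # 2 * (u * v)  ≈⟨ +-congʳ (+-cong uu vv) ⟩
    x + y - # 2 * (u * v)        ∎) (sq-mono-≤ 0≤d p)

  module _ {d : Carrier} (0≤d : 0# ≤ d) where
    private
      D = d * d

    -- The square of the threshold is 2 - √3. In terms of `w` = √12, being at most 9/32 means w ≥
    -- 55/16, which follows from 55² ≤ 16² · 12.
    below-d₁ : d ≤ (√ # 6 - √ # 2) / # 2 → Admissible D
    below-d₁ p = admissible-small (≤-trans 32D≤ (≤-by (≤⇒0≤- 55≤16w)
      (solve 1 (λ w → :# 9 := :# 64 :- :# 16 :* w :+ (:# 16 :* w :- :# 55)) refl w)))
      where
      w = √ # 6 * √ # 2
      55≤16w : # 55 ≤ # 16 * w
      55≤16w = ≤-* 55 16 12 0 (*-nonNegative (√-nonNegative (# 6)) (√-nonNegative (# 2))) (begin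
        # 1 * (w * w)
          ≈⟨ solve 2 (λ r s → :# 1 :* (r :* s :* (r :* s)) := r :* r :* (s :* s)) refl (√ # 6) (√ # 2) ⟩
        √ # 6 * √ # 6 * (√ # 2 * √ # 2)   ≈⟨ *-cong (√# 6) (√# 2) ⟩
        # 6 * # 2                         ≈⟨ solve 0 (:# 6 :* :# 2 := :# 12) refl ⟩
        # 12                              ∎)
      32D≤ : # 32 * D ≤ # 64 - # 16 * w
      32D≤ = ≤-respˡ-≈ (solve 1 (λ d → :# 8 :* (:# 2 :* d :* (:# 2 :* d)) := :# 32 :* (d :* d)) refl d)
        (≤-respʳ-≈ (solve 1 (λ w → :# 8 :* (:# 6 :+ :# 2 :- :# 2 :* w) := :# 64 :- :# 16 :* w) refl w)
          (*-monoʳ-≤ (0≤fromℕ 8) (sq-≤-difference (*-nonNegative (0≤fromℕ 2) 0≤d) (≤-/⇒*-≤ 1 p) (√# 6) (√# 2))))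

    -- The square of the threshold is 17/15 - 2w with w = √(14/75). The estimate w ≥ 3/7 brings it
    -- below 9/32; the factor 105 clears the denominators.
    below-d₂ : d ≤ √ (# 14 / # 15) - # 1 / √ # 5 → Admissible D
    below-d₂ p = admissible-small (fromℕ-cancel-≤ 104 (≤-trans 3360D≤ (≤-by (0≤+ (*-nonNegative (0≤fromℕ 960) (≤⇒0≤- 3≤7w)) (0≤fromℕ 17))
      (solve 1 (λ w → :# 105 :* :# 9 := :# 3808 :- :# 6720 :* w :+ (:# 960 :* (:# 7 :* w :- :# 3) :+ :# 17)) refl w))))
      where
      r = √ (# 14 / # 15)
      v = # 1 / √ # 5
      w = r * v
      0≤14/15 : 0# ≤ # 14 / # 15
      0≤14/15 = fromℕ-cancel-≤ 14 (≤-respˡ-≈ (sym (zeroʳ _)) (≤-respʳ-≈ (sym (*-/-cancel _ (fromℕ-suc≉0 14))) (0≤fromℕ 14)))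
      15rr : # 15 * (r * r) ≈ # 14
      15rr = trans (*-congˡ (√-square 0≤14/15)) (*-/-cancel _ (fromℕ-suc≉0 14))
      5vv : # 5 * (v * v) ≈ # 1
      5vv = trans (*-congˡ (*-cong (#1* k) (#1* k))) 5k²≈1
      3≤7w : # 3 ≤ # 7 * w
      3≤7w = ≤-* 3 7 14 74 (*-nonNegative (√-nonNegative _) (≤-respʳ-≈ (sym (#1* k)) 0≤k)) (begin
        # 75 * (w * w)
          ≈⟨ solve 2 (λ r v → :# 75 :* (r :* v :* (r :* v)) := :# 15 :* (r :* r) :* (:# 5 :* (v :* v))) refl r v ⟩
        # 15 * (r * r) * (# 5 * (v * v))   ≈⟨ *-cong 15rr 5vv ⟩
        # 14 * # 1                         ≈⟨ solve 0 (:# 14 :* :# 1 := :# 14) refl ⟩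
        # 14                               ∎)
      3360D≤ : # 105 * (# 32 * D) ≤ # 3808 - # 6720 * w
      3360D≤ = ≤-respˡ-≈ (solve 1 (λ D → :# 3360 :* D := :# 105 :* (:# 32 :* D)) refl D)
        (≤-respʳ-≈ (begin
          # 3360 * (r * r + v * v - # 2 * w)
            ≈⟨ solve 3 (λ x y w → :# 3360 :* (x :+ y :- :# 2 :* w) := :# 224 :* (:# 15 :* x) :+ :# 672 :* (:# 5 :* y) :- :# 6720 :* w)
                 refl (r * r) (v * v) w ⟩
          # 224 * (# 15 * (r * r)) + # 672 * (# 5 * (v * v)) - # 6720 * w
            ≈⟨ +-congʳ (+-cong (*-congˡ 15rr) (*-congˡ 5vv)) ⟩
          # 224 * # 14 + # 672 * # 1 - # 6720 * w
            ≈⟨ solve 1 (λ w → :# 224 :* :# 14 :+ :# 672 :* :# 1 :- :# 6720 :* w := :# 3808 :- :# 6720 :* w) refl w ⟩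
          # 3808 - # 6720 * w  ∎)
        (*-monoʳ-≤ (0≤fromℕ 3360) (sq-≤-difference 0≤d p refl refl)))

    -- The square (9 - √45)/8 of this threshold is exactly the smaller root of 16D² - 36D + 9 and
    -- exceeds 9/32. The polynomial is therefore factored: four times it equals x(x + 2w), where w =
    -- √45 and x = 9 - w - 8D ≥ 0.
    below-d₃ : d ≤ √ # 15 / # 4 - √ # 3 / # 4 → Admissible D
    below-d₃ p =
      fromℕ-cancel-≤ 7 (≤-trans 8D≤ (≤-by (0≤+ (0≤fromℕ 23) 0≤w) (solve 1 (λ w →
        :# 8 :* :# 4 := :# 9 :- w :+ (:# 23 :+ w)) refl w))) ,
      fromℕ-cancel-≤ 3 (≤-by (*-nonNegative 0≤x (0≤+ 0≤x (0≤+ 0≤w 0≤w))) (begin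
        # 4 * (# 16 * (D * D) + # 9)
          ≈⟨ solve 2 (λ D w → let x = :# 9 :- w :- :# 8 :* D in
               :# 4 :* (:# 16 :* (D :* D) :+ :# 9)
               := :# 4 :* (:# 36 :* D) :+ (x :* (x :+ (w :+ w)) :+ (w :* w :- :# 45))) refl D w ⟩
        # 4 * (# 36 * D) + (x * (x + (w + w)) + (w * w - # 45))
          ≈⟨ +-congˡ (+-congˡ (trans (+-congʳ ww) (-‿inverseʳ (# 45)))) ⟩
        # 4 * (# 36 * D) + (x * (x + (w + w)) + 0#)
          ≈⟨ +-congˡ (+-identityʳ _) ⟩
        # 4 * (# 36 * D) + x * (x + (w + w))   ∎))
      where
      w = √ # 15 * √ # 3
      x = # 9 - w - # 8 * D
      0≤w : 0# ≤ w
      0≤w = *-nonNegative (√-nonNegative (# 15)) (√-nonNegative (# 3))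
      ww : w * w ≈ # 45
      ww = begin
        w * w   ≈⟨ solve 2 (λ r s → r :* s :* (r :* s) := r :* r :* (s :* s)) refl (√ # 15) (√ # 3) ⟩
        √ # 15 * √ # 15 * (√ # 3 * √ # 3)   ≈⟨ *-cong (√# 15) (√# 3) ⟩
        # 15 * # 3                          ≈⟨ solve 0 (:# 15 :* :# 3 := :# 45) refl ⟩
        # 45                                ∎
      4d≤ : # 4 * d ≤ √ # 15 - √ # 3
      4d≤ = ≤-respʳ-≈ (begin
        # 4 * (√ # 15 / # 4 - √ # 3 / # 4)
          ≈⟨ solve 3 (λ n a b → n :* (a :- b) := n :* a :- n :* b) refl (# 4) (√ # 15 / # 4) (√ # 3 / # 4) ⟩
        # 4 * (√ # 15 / # 4) - # 4 * (√ # 3 / # 4)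
          ≈⟨ +-cong (*-/-cancel _ (fromℕ-suc≉0 3)) (-‿cong (*-/-cancel _ (fromℕ-suc≉0 3))) ⟩
        √ # 15 - √ # 3   ∎) (*-monoʳ-≤ (0≤fromℕ 4) p)
      8D≤ : # 8 * D ≤ # 9 - w
      8D≤ = fromℕ-cancel-≤ 1 (≤-respˡ-≈ (solve 1 (λ d → :# 4 :* d :* (:# 4 :* d) := :# 2 :* (:# 8 :* (d :* d))) refl d)
        (≤-respʳ-≈ (solve 1 (λ w → :# 15 :+ :# 3 :- :# 2 :* w := :# 2 :* (:# 9 :- w)) refl w)
          (sq-≤-difference (*-nonNegative (0≤fromℕ 4) 0≤d) 4d≤ (√# 15) (√# 3))))
      0≤x : 0# ≤ x
      0≤x = ≤⇒0≤- 8D≤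


    -- The square of the threshold is (5 + 2√3)/4, and √3 ≥ 3/2 already makes it at least 2.
    ≥-d₄ : # 1 / # 2 * √ (# 5 + # 2 * √ # 3) ≤ d → # 63 ≤ # 32 * D
    ≥-d₄ p = ≤-trans (≤-by (0≤+ (*-nonNegative (0≤fromℕ 8) (≤⇒0≤- 3≤2s)) (0≤fromℕ 1))
        (solve 1 (λ s → :# 8 :* (:# 5 :+ :# 2 :* s) := :# 63 :+ (:# 8 :* (:# 2 :* s :- :# 3) :+ :# 1)) refl s))
      (≤-respʳ-≈ (solve 1 (λ d → :# 8 :* (:# 2 :* d :* (:# 2 :* d)) := :# 32 :* (d :* d)) refl d)
        (*-monoʳ-≤ (0≤fromℕ 8) (≤-respˡ-≈ (√-square 0≤a) (sq-mono-≤ (√-nonNegative a) r≤2d))))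
      where
      s = √ # 3
      a = # 5 + # 2 * s
      0≤a : 0# ≤ a
      0≤a = 0≤+ (0≤fromℕ 5) (*-nonNegative (0≤fromℕ 2) (√-nonNegative (# 3)))
      3≤2s : # 3 ≤ # 2 * s
      3≤2s = ≤-* 3 2 3 0 (√-nonNegative (# 3)) (trans (#1* _) (√# 3))
      r≤2d : √ a ≤ # 2 * d
      r≤2d = ≤-respˡ-≈ (begin
        # 2 * (# 1 / # 2 * √ a)   ≈⟨ *-assoc _ _ _ ⟨
        # 2 * (# 1 / # 2) * √ a   ≈⟨ *-congʳ (*-/-cancel _ (fromℕ-suc≉0 1)) ⟩
        # 1 * √ a                 ≈⟨ #1* _ ⟩
        √ a                       ∎) (*-monoʳ-≤ (0≤fromℕ 2) p)

    private
      a₅ = # 19 / # 15 + # 2 / √ # 5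
      0≤a₅ : 0# ≤ a₅
      0≤a₅ = 0≤+ (fromℕ-cancel-≤ 14 (≤-respˡ-≈ (sym (zeroʳ _)) (≤-respʳ-≈ (sym (*-/-cancel _ (fromℕ-suc≉0 14))) (0≤fromℕ 19))))
        (*-nonNegative (0≤fromℕ 2) 0≤k)
      15a₅ : # 15 * a₅ ≈ # 19 + # 30 * k
      15a₅ = trans (solve 2 (λ x k → :# 15 :* (x :+ :# 2 :* k) := :# 15 :* x :+ :# 30 :* k) refl (# 19 / # 15) k)
        (+-congʳ (*-/-cancel _ (fromℕ-suc≉0 14)))

    -- With 1/√5 ≥ 2/5 the square of the threshold is at least 31/15, which exceeds 63/32.
    ≥-d₅ : √ a₅ ≤ d → # 63 ≤ # 32 * D
    ≥-d₅ p = fromℕ-cancel-≤ 14 (≤-trans (≤-by (0≤+ (*-nonNegative (0≤fromℕ 192) (≤⇒0≤- 2≤5k)) (0≤fromℕ 47))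
        (solve 1 (λ k → :# 32 :* (:# 19 :+ :# 30 :* k) := :# 15 :* :# 63 :+ (:# 192 :* (:# 5 :* k :- :# 2) :+ :# 47)) refl k))
      (≤-respˡ-≈ (*-congˡ 15a₅) (≤-respʳ-≈ (solve 1 (λ D → :# 32 :* (:# 15 :* D) := :# 15 :* (:# 32 :* D)) refl D)
        (*-monoʳ-≤ (0≤fromℕ 32) (*-monoʳ-≤ (0≤fromℕ 15)
          (≤-respˡ-≈ (√-square 0≤a₅) (sq-mono-≤ (√-nonNegative a₅) p)))))))
      where
      2≤5k : # 2 ≤ # 5 * k
      2≤5k = ≤-* 2 5 1 4 0≤k 5k²≈1

    ≤-d₅ : d ≤ √ a₅ → D ≤ # 4
    ≤-d₅ p = fromℕ-cancel-≤ 14 (≤-trans (*-monoʳ-≤ (0≤fromℕ 15) (≤-respʳ-≈ (√-square 0≤a₅) (sq-mono-≤ 0≤d p)))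
      (≤-respˡ-≈ (sym 15a₅) (≤-by (0≤+ (*-nonNegative (0≤fromℕ 30) (≤⇒0≤- k≤1)) (0≤fromℕ 11))
        (solve 1 (λ k → :# 15 :* :# 4 := :# 19 :+ :# 30 :* k :+ (:# 30 :* (:# 1 :- :# 1 :* k) :+ :# 11)) refl k))))
      where
      k≤1 : # 1 * k ≤ # 1
      k≤1 = *-≤ 1 1 1 4 5k²≈1

    private
      a s a₆ : Carrier
      a = √ # 2
      s = √ # 3
      a₆ = # 1 / # 2 * (# 2 + a) * (# 3 - s)
      aa : # 1 * (a * a) ≈ # 2
      aa = trans (#1* _) (√# 2)
      ss : # 1 * (s * s) ≈ # 3
      ss = trans (#1* _) (√# 3)
      0≤2+a : 0# ≤ # 2 + a
      0≤2+a = 0≤+ (0≤fromℕ 2) (√-nonNegative (# 2))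
      s≤2 : # 1 * s ≤ # 2
      s≤2 = *-≤ 2 1 3 0 ss
      0≤3-s : 0# ≤ # 3 - s
      0≤3-s = ≤-respʳ-≈ (solve 1 (λ s → :# 2 :- :# 1 :* s :+ :# 1 := :# 3 :- s) refl s) (0≤+ (≤⇒0≤- s≤2) (0≤fromℕ 1))
      2a₆ : # 2 * a₆ ≈ (# 2 + a) * (# 3 - s)
      2a₆ = begin
        # 2 * (# 1 / # 2 * (# 2 + a) * (# 3 - s))
          ≈⟨ solve 4 (λ n h x y → n :* (h :* x :* y) := n :* h :* (x :* y)) refl (# 2) (# 1 / # 2) (# 2 + a) (# 3 - s) ⟩
        # 2 * (# 1 / # 2) * ((# 2 + a) * (# 3 - s))   ≈⟨ *-congʳ (*-/-cancel _ (fromℕ-suc≉0 1)) ⟩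
        # 1 * ((# 2 + a) * (# 3 - s))                 ≈⟨ #1* _ ⟩
        (# 2 + a) * (# 3 - s)                         ∎
      0≤a₆ : 0# ≤ a₆
      0≤a₆ = fromℕ-cancel-≤ 1 (≤-respˡ-≈ (sym (zeroʳ _)) (≤-respʳ-≈ (sym 2a₆) (*-nonNegative 0≤2+a 0≤3-s)))

    -- From √2 ≥ 4/3 and √3 ≤ 7/4 the factors are at least 10/3 and 5/4, so the square of the
    -- threshold is at least 25/12.
    ≥-d₆ : √ a₆ ≤ d → # 63 ≤ # 32 * D
    ≥-d₆ p = fromℕ-cancel-≤ 2 (≤-trans (≤-by (0≤fromℕ 11) (solve 0 (:# 4 :* (:# 10 :* :# 5) := :# 3 :* :# 63 :+ :# 11) refl))
      (≤-trans (*-monoʳ-≤ (0≤fromℕ 4) (*-mono-≤ (0≤fromℕ 10) (0≤fromℕ 5) 10≤ 5≤))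
      (≤-respˡ-≈ (begin
          # 48 * (# 2 * a₆)                    ≈⟨ *-congˡ 2a₆ ⟩
          # 48 * ((# 2 + a) * (# 3 - s))
            ≈⟨ solve 2 (λ x y → :# 48 :* (x :* y) := :# 4 :* (:# 3 :* x :* (:# 4 :* y))) refl (# 2 + a) (# 3 - s) ⟩
          # 4 * (# 3 * (# 2 + a) * (# 4 * (# 3 - s)))  ∎)
        (≤-respʳ-≈ (solve 1 (λ D → :# 48 :* (:# 2 :* D) := :# 3 :* (:# 32 :* D)) refl D)
          (*-monoʳ-≤ (0≤fromℕ 48) (*-monoʳ-≤ (0≤fromℕ 2)
            (≤-respˡ-≈ (√-square 0≤a₆) (sq-mono-≤ (√-nonNegative a₆) p))))))))
      where
      4≤3a : # 4 ≤ # 3 * a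
      4≤3a = ≤-* 4 3 2 0 (√-nonNegative (# 2)) aa
      4s≤7 : # 4 * s ≤ # 7
      4s≤7 = *-≤ 7 4 3 0 ss
      10≤ : # 10 ≤ # 3 * (# 2 + a)
      10≤ = ≤-by (≤⇒0≤- 4≤3a) (solve 1 (λ a → :# 3 :* (:# 2 :+ a) := :# 10 :+ (:# 3 :* a :- :# 4)) refl a)
      5≤ : # 5 ≤ # 4 * (# 3 - s)
      5≤ = ≤-by (≤⇒0≤- 4s≤7) (solve 1 (λ s → :# 4 :* (:# 3 :- s) := :# 5 :+ (:# 7 :- :# 4 :* s)) refl s)

    ≤-d₆ : d ≤ √ a₆ → D ≤ # 4
    ≤-d₆ p = fromℕ-cancel-≤ 1 (≤-trans (*-monoʳ-≤ (0≤fromℕ 2) (≤-respʳ-≈ (√-square 0≤a₆) (sq-mono-≤ 0≤d p)))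
      (≤-respˡ-≈ (sym 2a₆) (≤-respʳ-≈ (solve 0 (:# 4 :* :# 2 := :# 2 :* :# 4) refl) (*-mono-≤ 0≤2+a 0≤3-s ≤4 ≤2))))
      where
      a≤2 : # 1 * a ≤ # 2
      a≤2 = *-≤ 2 1 2 0 aa
      1≤s : # 1 ≤ # 1 * s
      1≤s = ≤-* 1 1 3 0 (√-nonNegative (# 3)) ss
      ≤4 : # 2 + a ≤ # 4
      ≤4 = ≤-by (≤⇒0≤- a≤2) (solve 1 (λ a → :# 4 := :# 2 :+ a :+ (:# 2 :- :# 1 :* a)) refl a)
      ≤2 : # 3 - s ≤ # 2
      ≤2 = ≤-by (≤⇒0≤- 1≤s) (solve 1 (λ s → :# 2 := :# 3 :- s :+ (:# 1 :* s :- :# 1)) refl s)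

    ≤-2 : d ≤ # 2 → D ≤ # 4
    ≤-2 p = ≤-respʳ-≈ (solve 0 (:# 2 :* :# 2 := :# 4) refl) (sq-mono-≤ 0≤d p)

  -- Weakens 1/72 to a stated bound. The denominator is passed as its predecessor `b`, which makes
  -- it visibly nonzero.
  fraction-≤ : ∀ a b {q} {h : True (a ℕ.* 72 ℕ.≤? suc b)} → 0# ≤ q → # 1 ≤ # 72 * q → # a / # (suc b) ≤ q
  fraction-≤ a b {q} {h} 0≤q p = fromℕ-cancel-≤ b (≤-respˡ-≈ (sym (*-/-cancel _ (fromℕ-suc≉0 b)))
    (≤-trans (≤-respˡ-≈ (trans (*-congˡ (+-identityʳ 1#)) (*-identityʳ (# a))) (*-monoʳ-≤ (0≤fromℕ a) p))
      (≤-respˡ-≈ (trans (*-congʳ (×1-homo-* a 72)) (*-assoc _ _ _))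
        (*-mono-≤ (0≤fromℕ (a ℕ.* 72)) 0≤q (fromℕ-mono-≤ (toWitness h)) ≤-refl))))

mainTheorem8 :
  (ℝ : CompleteOrderedField) →
  let open CompleteOrderedField ℝ
      open SquareRoot ℝ using (√_)
      open Plane ℝ
      # = fromℕ
  in
  (c₀ : ProperColouring) (P : InvariantProbability ℝ S₄×E₂) →
  (d : Carrier) → 0# ≤ d →
  (A B : Point) → dist A B ≈ d →
  let p = monochromaticity c₀ P A B
      d₁ = (√ # 6 - √ # 2) / # 2
      d₂ = √ (# 14 / # 15) - # 1 / √ # 5
      d₃ = √ # 15 / # 4 - √ # 3 / # 4
      d₄ = # 1 / # 2 * √ (# 5 + # 2 * √ # 3)
      d₅ = √ (# 19 / # 15 + # 2 / √ # 5)
      d₆ = √ (# 1 / # 2 * (# 2 + √ # 2) * (# 3 - √ # 3))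
  in
    (d ≤ d₁          → # 1 / # 75 ≤ p)
  × (d₁ < d → d ≤ d₂ → # 28 / # 2325 ≤ p)
  × (d₂ < d → d ≤ d₃ → # 1 / # 150 ≤ p)
  × (d₄ ≤ d → d < d₅ → # 1 / # 150 ≤ p)
  × (d₅ ≤ d → d < d₆ → # 28 / # 2325 ≤ p)
  × (d₆ ≤ d → d ≤ # 2 → # 1 / # 75 ≤ p)
mainTheorem8 ℝ c₀ P d 0≤d A B AB =
    (λ d≤d₁ → fraction-≤ 1 74 0≤p (bound (below-d₁ 0≤d d≤d₁)))
  , (λ _ d≤d₂ → fraction-≤ 28 2324 0≤p (bound (below-d₂ 0≤d d≤d₂)))
  , (λ _ d≤d₃ → fraction-≤ 1 149 0≤p (bound (below-d₃ 0≤d d≤d₃)))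
  -- For the large distances the lower end of the range gives 32d² ≥ 63, and the upper end yields d
  -- ≤ 2; `proj₁` weakens the strict inequality.
  , (λ d₄≤d d<d₅ → fraction-≤ 1 149 0≤p
      (bound (admissible-large (≥-d₄ 0≤d d₄≤d) (≤-d₅ 0≤d (proj₁ d<d₅)))))
  , (λ d₅≤d d<d₆ → fraction-≤ 28 2324 0≤p
      (bound (admissible-large (≥-d₅ 0≤d d₅≤d) (≤-d₆ 0≤d (proj₁ d<d₆)))))
  , (λ d₆≤d d≤2 → fraction-≤ 1 74 0≤p
      (bound (admissible-large (≥-d₆ 0≤d d₆≤d) (≤-2 0≤d d≤2))))
  where
  open CompleteOrderedField ℝ
  open RealArithmetic ℝ
  open Distances ℝ
  open Thresholds ℝ
  open Plane ℝ
  p = monochromaticity c₀ P A B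
  0≤p : 0# ≤ p
  0≤p = InvariantProbability.nonNegative P (monochromatic c₀ A B)
  bound : Admissible (d * d) → # 1 ≤ # 72 * p
  bound = p-≥-1/72 c₀ P {d} {A} {B} 0≤d AB
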